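{- Let $M,N\ge 3$ be integers. (1) Let $x\in\{ -1,1\}^N$. In the symmetric toroidal Hitomezashi pattern $\mathrm{Cloth}_{N,N}(x,x)$, every nontrivial toroidal Hitomezashi loop has homology class $(1,1)$ if $k(x)>0$, and homology class $(-1,-1)$ if $k(x)<0$. If $k(x)=0$, no nontrivial toroidal Hitomezashi loop exists. (2) Let $x\in\{ -1,1\}^N$, $y\in\{ -1,1\}^M$. In the toroidal Hitomezashi pattern $\mathrm{Cloth}_{M,N}(x,y)$, the possible homology classes of a nontrivial toroidal Hitomezashi loop are as follows: - if $k(x)\neq 0$ and $k(y)\ne 0$: $\left(\frac{k(x)}{\gcd(x,y)},\frac{k(y)}{\gcd(x,y)}\right)$; - if $k(x)=0$ and $k(y)\neq 0$: $(0,\pm1)$; - if $k(x)\ne 0$ and $k(y)=0$: $(\pm1,0)$; - if $k(x)=k(y)=0$: $(0,\pm1)$ or $(\pm1,0)$. (That is, every nontrivial toroidal Hitomezashi loop of the pattern has its homology class in the indicated list.)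
   Context: Let $M,N\ge3$. $\mathrm{Cloth}_{M,N}$ is the graph with vertex set $\mathbb Z/M\mathbb Z\times\mathbb Z/N\mathbb Z$, with $(i,j)$ adjacent to $(i\pm1,j)$ and $(i,j\pm1)$. For $x\in\{ -1,1\}^N$ (indexed by $\mathbb Z/N\mathbb Z$) and $y\in\{ -1,1\}^M$ (indexed by $\mathbb Z/M\mathbb Z$), the toroidal Hitomezashi pattern $\mathrm{Cloth}_{M,N}(x,y)$ is the following orientation of $\mathrm{Cloth}_{M,N}$: the horizontal edge $\{(i,j),(i+1,j)\}$ is oriented $(i,j)\to(i+1,j)$ if $x_j=1$ and $(i+1,j)\to(i,j)$ if $x_j=-1$; the vertical edge $\{(i,j),(i,j+1)\}$ is oriented $(i,j)\to(i,j+1)$ if $y_i=1$ and $(i,j+1)\to(i,j)$ if $y_i=-1$. The pattern is symmetric if $M=N$ and $x=y$. A toroidal Hitomezashi loop is a directed circuit (closed directed trail, no repeated edges, considered up to cyclic shift) in $\mathrm{Cloth}_{M,N}(x,y)$ whose edges alternate (cyclically) between vertical and horizontal edges; a loop may pass through a vertex twice. The edge set is partitioned into such loops. For a loop, $\Delta x$ is the number of its edges of the form $(i,j)\to(i+1,j)$ minus the number of its edges of the form $(i+1,j)\to(i,j)$, and $\Delta y$ is the number of its edges of the form $(i,j)\to(i,j+1)$ minus the number of the form $(i,j+1)\to(i,j)$. The homology class of the loop is $(\Delta x/M,\Delta y/N)$. A loop is trivial if its homology class is $(0,0)$ and nontrivial otherwise. For a string $x$ of $\pm1$'s, $k(x)$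 is the number of $1$'s minus the number of $(-1)$'s in $x$. $\gcd(x,y)$ denotes $\gcd(|k(x)|,|k(y)|)$. -}

module Defs where

open import Data.Fin.Base using (Fin; toℕ)
open import Data.Integer.Base as ℤ using (ℤ; 0ℤ; ∣_∣)
open import Data.Integer.Properties using (∣i∣≡0⇒i≡0)
open import Data.Nat.Base as ℕ using (ℕ; suc)
open import Data.Nat.DivMod using (_mod_)
open import Data.Nat.GCD using (gcd; gcd[m,n]≢0)
open import Data.Product.Base using (_×_; _,_; proj₁)
open import Data.Product.Properties using (≡-dec)
open import Data.Rational.Base using (ℚ; 0ℚ; _/_)
open import Data.Sign.Base as Sign using (Sign)
open import Data.Sign.Properties as Sign using ()
open import Data.Sum.Base using (inj₁)
open import Data.Vec.Base using (Vec; lookup; count)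
open import Data.Vec.Relation.Unary.Unique.Propositional using (Unique)
open import Function.Base using (_∘_)
open import Relation.Binary.Definitions using (DecidableEquality)
open import Relation.Binary.PropositionalEquality using (_≡_; _≢_; refl)
open import Relation.Nullary.Decidable using (yes; no)

private
  variable
    M N n : ℕ

-- Fin n stands for ℤ/nℤ; next is i ↦ i + 1 modulo n.
next : Fin n → Fin n
next {suc n} i = suc (toℕ i) mod suc n

-- Sign.+ and Sign.- encode 1 and -1.
k : Vec Sign n → ℤ
k x = ℤ.+ count (Sign._≟ Sign.+) x ℤ.- ℤ.+ count (Sign._≟ Sign.-) x

gcdₖ : Vec Sign N → Vec Sign M → ℕ
gcdₖ x y = gcd ∣ k x ∣ ∣ k y ∣

gcdₖ-nonZero : (x : Vec Sign N) (y : Vec Sign M) → k x ≢ 0ℤ → ℕ.NonZero (gcdₖ x y)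
gcdₖ-nonZero x y kx≢0 =
  ℕ.≢-nonZero (gcd[m,n]≢0 ∣ k x ∣ ∣ k y ∣ (inj₁ (kx≢0 ∘ ∣i∣≡0⇒i≡0)))

data Axis : Set where
  horizontal vertical : Axis

_≟ᴬ_ : DecidableEquality Axis
horizontal ≟ᴬ horizontal = yes refl
horizontal ≟ᴬ vertical   = no λ ()
vertical   ≟ᴬ horizontal = no λ ()
vertical   ≟ᴬ vertical   = yes refl

Vertex : ℕ → ℕ → Set
Vertex M N = Fin M × Fin N

-- (horizontal , i , j) is the undirected edge {(i,j), (i+1,j)} and
-- (vertical , i , j) is {(i,j), (i,j+1)}.  For M, N ≥ 3 every edge of
-- Cloth M N is named exactly once in this way.
Edge : ℕ → ℕ → Set
Edge M N = Axis × Vertex M N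

axis : Edge M N → Axis
axis = proj₁

lower upper : Edge M N → Vertex M N
lower (_          , v)     = v
upper (horizontal , i , j) = next i , j
upper (vertical   , i , j) = i , next j

module Pattern {M N : ℕ} (x : Vec Sign N) (y : Vec Sign M) where

  -- Sign.+ : oriented from lower to upper;  Sign.- : from upper to lower.
  orientation : Edge M N → Sign
  orientation (horizontal , i , j) = lookup x j
  orientation (vertical   , i , j) = lookup y i

  source target : Edge M N → Vertex M N
  source e with orientation e
  ... | Sign.+ = lower e
  ... | Sign.- = upper e
  target e with orientation e
  ... | Sign.+ = upper e
  ... | Sign.- = lower e

  heading : Edge M N → Axis × Sign
  heading e = axis e , orientation e

  -- A directed circuit with a chosen first edge.  Everything said about loops
  -- is independent of that choice, so cyclic shifts are not identified.
  -- Indices of edges are cyclic: next sends the last index to the first.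
  record Loop : Set where
    field
      {length-1}  : ℕ
      edges       : Vec (Edge M N) (suc length-1)
      connected   : ∀ i → target (lookup edges i) ≡ source (lookup edges (next i))
      trail       : Unique edges
      alternating : ∀ i → axis (lookup edges i) ≢ axis (lookup edges (next i))

  #heading : Axis × Sign → Loop → ℕ
  #heading h L = count (λ e → ≡-dec _≟ᴬ_ Sign._≟_ (heading e) h) (Loop.edges L)

  Δx Δy : Loop → ℤ
  Δx L = ℤ.+ #heading (horizontal , Sign.+) L ℤ.- ℤ.+ #heading (horizontal , Sign.-) L
  Δy L = ℤ.+ #heading (vertical   , Sign.+) L ℤ.- ℤ.+ #heading (vertical   , Sign.-) L

  module _ .{{_ : ℕ.NonZero M}} .{{_ : ℕ.NonZero N}} where

    homologyClass : Loop → ℚ × ℚ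
    homologyClass L = Δx L / M , Δy L / N

    Nontrivial : Loop → Set
    Nontrivial L = homologyClass L ≢ (0ℚ , 0ℚ)

open Pattern public using (Loop; homologyClass; Nontrivial)

-- (k(x)/gcd(x,y), k(y)/gcd(x,y)); the hypothesis makes the gcd nonzero.
k/gcd : (x : Vec Sign N) (y : Vec Sign M) → k x ≢ 0ℤ → ℚ × ℚ
k/gcd x y kx≢0 = k x / gcdₖ x y , k y / gcdₖ x y
  where instance _ = gcdₖ-nonZero x y kx≢0

{-# OPTIONS --safe #-}

-- Refine the grid by a factor of two, so that the midpoints of the edges of a
-- loop, lifted to the universal cover ℤ × ℤ, form a walk (u, v) with diagonal
-- unit steps.  Integrating x and y gives height functions F of v and G of u
-- with slopes ±1, and each step of the walk changes F(v) and G(u) by the same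
-- amount δu · δv.  So F(v) − G(u) is constant along the walk, and comparing
-- its values one period apart forces the class (a, b) of the loop to be
-- parallel to (k(x), k(y)).
--
-- For k(x), k(y) > 0 let 2τ be a first passage of F to some height and S the
-- first passage of G to the matching height.  Along the boundary of the
-- quadrant {u < S, v ≤ 2τ} the value of F − G equals that of the walk only
-- near the corner, where the walk can leave the quadrant but not enter it.
-- Hence a and b are not negative, and every walk of this level uses the corner
-- edge of this quadrant and also that of its translate by the primitive
-- vector parallel to (k(x), k(y)).  A loop has no repeated edges, so the
-- primitive vector is a multiple of (a, b).  The other signs follow by
-- reflection.  When k(x) = 0 and b > 0, a highest row of F plays the role of
-- the quadrant: all upward crossings of its translates lie in one column, so
-- (a, b) = (0, 1).  In a symmetric pattern a loop never crosses the diagonal,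
-- so a = b.

module Submission where

open import Defs
open import Data.Empty using (⊥; ⊥-elim)
open import Data.Fin.Base as Fin using (Fin; toℕ)
import Data.Fin.Properties as Fin
open import Data.Integer.Base as ℤ
  using (ℤ; +_; -[1+_]; 0ℤ; _+_; _*_; _-_; -_; _≤_; _<_; _>_; ∣_∣; _/ℕ_; _%ℕ_)
open import Data.Integer.Divisibility.Signed as Signed using (divides)
open import Data.Integer.DivMod using (a≡a%ℕn+[a/ℕn]*n; n%ℕd<d)
import Data.Integer.Properties as ℤ
import Data.Integer.Tactic.RingSolver as ℤRing
open import Data.Nat.Base as ℕ using (ℕ; zero; suc; NonZero; _≥_)
import Data.Nat.Divisibility as ℕ
open import Data.Nat.DivMod using (_mod_)
import Data.Nat.DivMod as ℕ
open import Data.Nat.GCD using (gcd-greatest; gcd[m,n]∣m; gcd[m,n]∣n)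
import Data.Nat.Properties as ℕ
open import Data.Product.Base using (_×_; _,_; proj₁; proj₂; ∃; ∃₂; ∃-syntax)
open import Data.Product.Properties using (≡-dec)
open import Data.Rational.Base as ℚ using (ℚ; 0ℚ; 1ℚ)
import Data.Rational.Properties as ℚ
open import Data.Rational.Unnormalised.Base using (mkℚᵘ; *≡*)
open import Data.Sign.Base as Sign using (Sign)
import Data.Sign.Properties as Sign
open import Data.Sum.Base as Sum using (_⊎_; inj₁; inj₂; [_,_]′)
open import Data.Vec.Base using (Vec; []; _∷_; lookup; count)
open import Data.Vec.Relation.Unary.Unique.Propositional.Properties using (lookup-injective)
open import Function.Base using (_∘_; case_of_)
open import Relation.Binary.PropositionalEquality
  using (_≡_; _≢_; refl; sym; trans; cong; cong₂; subst; subst₂; module ≡-Reasoning)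
open import Relation.Nullary.Decidable using (Dec; yes; no)
open import Relation.Nullary.Negation.Core using (¬_)
open import Tactic.RingSolver.Core.Expression using (Expr; Κ; _⊕_; _⊗_; ⊝_)
import Tactic.RingSolver.NonReflective ℤRing.ring as Ring

open Ring using (solve)

-- Integer arithmetic with ring certificates

private
  infix  4 _:=_
  infixl 6 _⊖_

  _:=_ : ∀ {n} → Expr ℤ n → Expr ℤ n → Expr ℤ n × Expr ℤ n
  _:=_ = _,_

  _⊖_ : ∀ {n} → Expr ℤ n → Expr ℤ n → Expr ℤ n
  e ⊖ f = e ⊕ ⊝ f

  con : ∀ {n} → ℕ → Expr ℤ n
  con c = Κ (+ c)

-- Linear arithmetic by certificates: the hypothesis of linear, absurd and
-- linear≡ is a linear combination of known facts, n measures the slack left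
-- over, and the last argument is a ring identity.  Strict inequalities x < y
-- are written x + 1 ≤ y.

infixl 6 _+≤_ _+≡_

_+≤_ : ∀ {a b c d} → a ≤ b → c ≤ d → a + c ≤ b + d
_+≤_ = ℤ.+-mono-≤

_+≡_ : ∀ {a b c d : ℤ} → a ≡ b → c ≡ d → a + c ≡ b + d
_+≡_ = cong₂ _+_

≡⇒≤ : ∀ {a b} → a ≡ b → a ≤ b
≡⇒≤ = ℤ.≤-reflexive

≡⇒≥ : ∀ {a b} → a ≡ b → b ≤ a
≡⇒≥ = ℤ.≤-reflexive ∘ sym

0≤+ : ∀ n → + 0 ≤ + n
0≤+ n = ℤ.+≤+ ℕ.z≤n

linear : ∀ n {a b x y} → a ≤ b → y - x ≡ b - a + + n → x ≤ y
linear n a≤b eq =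
  ℤ.0≤i-j⇒j≤i (subst (+ 0 ≤_) (sym eq) (ℤ.+-mono-≤ (ℤ.i≤j⇒0≤j-i a≤b) (0≤+ n)))

absurd : ∀ n {a b} → a ≤ b → b - a ≡ -[1+ n ] → ⊥
absurd n a≤b eq with subst (+ 0 ≤_) eq (ℤ.i≤j⇒0≤j-i a≤b)
... | ()

linear≡ : ∀ {a b x y} → a ≡ b → x - y ≡ a - b → x ≡ y
linear≡ {x = x} {y} a≡b eq = ℤ.i-j≡0⇒i≡j x y (trans eq (ℤ.i≡j⇒i-j≡0 a≡b))

1≤⇒0≤ : ∀ {i} → + 1 ≤ i → + 0 ≤ i
1≤⇒0≤ = ℤ.≤-trans (0≤+ 1)

infix 4 _<?≥_

_<?≥_ : ∀ x y → x + + 1 ≤ y ⊎ y ≤ x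
x <?≥ y with ℤ.≤-total y x
... | inj₁ y≤x = inj₂ y≤x
... | inj₂ x≤y with x ℤ.≟ y
... | yes refl = inj₂ ℤ.≤-refl
... | no  x≢y  = inj₁ (subst (_≤ y) (ℤ.+-comm (+ 1) x) (ℤ.i<j⇒suc[i]≤j (ℤ.≤∧≢⇒< x≤y x≢y)))

0≤* : ∀ {i j} → + 0 ≤ i → + 0 ≤ j → + 0 ≤ i * j
0≤* {+ m} {+ n} _ _ = subst (+ 0 ≤_) (ℤ.pos-* m n) (0≤+ (m ℕ.* n))

-- Expanding `0 ≤ (i - 1) * (j - 1)` gives `i + j - 1 ≤ i * j`.
1≤* : ∀ {i j} → + 1 ≤ i → + 1 ≤ j → + 1 ≤ i * j
1≤* {i} {j} 1≤i 1≤j =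
  linear 0 (0≤* (ℤ.i≤j⇒0≤j-i 1≤i) (ℤ.i≤j⇒0≤j-i 1≤j) +≤ 1≤i +≤ 1≤j)
      (solve 2 (λ a b → a ⊗ b ⊖ con 1 :=
          (a ⊖ con 1) ⊗ (b ⊖ con 1) ⊕ a ⊕ b ⊖ (con 0 ⊕ con 1 ⊕ con 1) ⊕ con 0) refl i j)

-- The same expansion gives `j ≤ 2 - i ≤ 1`, while `j < 1` would make the product nonpositive.
unit-factor : ∀ {i j} → + 1 ≤ i → + 1 ≡ i * j → j ≡ + 1
unit-factor {i} {j} 1≤i 1≡ij = ℤ.≤-antisym
  (linear 0 (0≤* (ℤ.i≤j⇒0≤j-i 1≤i) (ℤ.i≤j⇒0≤j-i 1≤j) +≤ 1≤i +≤ ≡⇒≥ 1≡ij)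
      (solve 2 (λ a b → con 1 ⊖ a :=
          (b ⊖ con 1) ⊗ (a ⊖ con 1) ⊕ b ⊕ con 1 ⊖ (con 0 ⊕ con 1 ⊕ b ⊗ a) ⊕ con 0) refl j i)) 1≤j
  where
  1≤j : + 1 ≤ j
  1≤j = case j <?≥ + 1 of λ where
    (inj₂ 1≤j) → 1≤j
    (inj₁ j<1) → ⊥-elim (absurd 0 (0≤* (1≤⇒0≤ 1≤i) (linear 0 {x = + 0} { - j} j<1
        (solve 1 (λ a → ⊝ a ⊖ con 0 := con 1 ⊖ (a ⊕ con 1) ⊕ con 0) refl j)) +≤ ≡⇒≤ 1≡ij)
        (solve 2 (λ a b → a ⊗ ⊝ b ⊕ a ⊗ b ⊖ (con 0 ⊕ con 1) := ⊝ con 1) refl i j))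

archimedes : ∀ i → ∃ λ n → i ≤ + n
archimedes (+ n)    = n , ℤ.≤-refl
archimedes -[1+ n ] = 0 , ℤ.-≤+

divide : ∀ {p} → + 1 ≤ p → ∀ z → ∃₂ λ r q → z ≡ r + q * p × + 0 ≤ r × r + + 1 ≤ p
divide {+ suc n} _ z =
  + (z %ℕ suc n) , z /ℕ suc n , a≡a%ℕn+[a/ℕn]*n z (suc n) , 0≤+ _ ,
  subst (_≤ + suc n) (ℤ.+-comm (+ 1) (+ (z %ℕ suc n))) (ℤ.i<j⇒suc[i]≤j (ℤ.+<+ (n%ℕd<d z (suc n))))
divide {+ zero} (ℤ.+≤+ ())

Parity : ℤ → Set
Parity z = ∃ λ j → z ≡ + 2 * j ⊎ z ≡ + 2 * j + + 1

parity-+ : ∀ n → Parity (+ n)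
parity-+ zero    = + 0 , inj₁ refl
parity-+ (suc n) = case parity-+ n of λ where
  (j , inj₁ even) → j , inj₂ (linear≡ even
      (solve 2 (λ a b → con 1 ⊕ a ⊖ (b ⊕ con 1) := a ⊖ b) refl (+ n) (+ 2 * j)))
  (j , inj₂ odd)  → j + + 1 , inj₁ (linear≡ odd
      (solve 2 (λ a b → con 1 ⊕ a ⊖ con 2 ⊗ (b ⊕ con 1) := a ⊖ (con 2 ⊗ b ⊕ con 1)) refl (+ n) j))

parity : ∀ z → Parity z
parity (+ n)    = parity-+ n
parity -[1+ n ] = case parity-+ (suc n) of λ where
  (j , inj₁ even) → - j , inj₁ (linear≡ (cong -_ even)
      (solve 2 (λ a b → a ⊖ con 2 ⊗ ⊝ b := a ⊖ ⊝ (con 2 ⊗ b)) refl (- (+ 1 + + n)) j))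
  (j , inj₂ odd)  → - j - + 1 , inj₂ (linear≡ (cong -_ odd)
      (solve 2 (λ a b → a ⊖ (con 2 ⊗ (⊝ b ⊖ con 1) ⊕ con 1) := a ⊖ ⊝ (con 2 ⊗ b ⊕ con 1))
        refl (- (+ 1 + + n)) j))

even≢odd : ∀ i j → + 2 * i ≢ + 2 * j + + 1
even≢odd i j eq = case (i - j) <?≥ + 1 of λ where
  (inj₁ i-j<1) → absurd 0 (i-j<1 +≤ i-j<1 +≤ ≡⇒≥ eq)
      (solve 2 (λ a b → con 1 ⊕ con 1 ⊕ con 2 ⊗ a ⊖ (a ⊖ b ⊕ con 1 ⊕ (a ⊖ b ⊕ con 1) ⊕ (con 2 ⊗ b ⊕ con 1)) :=
          ⊝ con 1) refl i j)
  (inj₂ i-j≥1) → absurd 0 (i-j≥1 +≤ i-j≥1 +≤ ≡⇒≤ eq)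
      (solve 2 (λ a b → a ⊖ b ⊕ (a ⊖ b) ⊕ (con 2 ⊗ b ⊕ con 1) ⊖ (con 1 ⊕ con 1 ⊕ con 2 ⊗ a) :=
          ⊝ con 1) refl i j)

-- Height profiles

-- A sign string of length `N`, integrated on the refined grid. Lattice line `j` occupies the two
-- steps from `2j` to `2j + 2`, which by `line` have the same slope. A period therefore has length
-- `2 * N`, and `κ` is the height gained over it.
record Profile (N κ : ℤ) : Set where
  field
    ht    : ℤ → ℤ
    unit  : ∀ v → ht (v + + 1) ≡ ht v + + 1 ⊎ ht (v + + 1) ≡ ht v - + 1
    line  : ∀ j → ht (+ 2 * j + + 2) + ht (+ 2 * j) ≡ + 2 * ht (+ 2 * j + + 1)
    quasi : ∀ v → ht (v + + 2 * N) ≡ ht v + κ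

  -- A first passage on all of ℤ: no point to the left of `S`, however far, reaches `h`.
  Passage : ℤ → ℤ → Set
  Passage h S = ht S ≡ h × (∀ i → i + + 1 ≤ S → ht i + + 1 ≤ h)

  ≤-passage : ∀ {h S} → Passage h S → ∀ i → i ≤ S → ht i ≤ h
  ≤-passage {h} {S} (value , before) i i≤S = case i <?≥ S of λ where
    (inj₁ i<S) → linear 1 (before i i<S)
        (solve 2 (λ a b → a ⊖ b := a ⊖ (b ⊕ con 1) ⊕ con 1) refl h (ht i))
    (inj₂ S≤i) → ≡⇒≤ (trans (cong ht (ℤ.≤-antisym i≤S S≤i)) value)

  rise≤1 : ∀ v → ht (v + + 1) ≤ ht v + + 1
  rise≤1 v = [ (λ eq → ≡⇒≤ eq) , (λ eq → linear 2 (≡⇒≤ eq)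
      (solve 2 (λ a b → a ⊕ con 1 ⊕ b := a ⊖ con 1 ⊕ b ⊕ con 2)
        refl (ht v) (- ht (v + + 1)))) ]′ (unit v)

  fall≤1 : ∀ v → ht v ≤ ht (v + + 1) + + 1
  fall≤1 v = [ (λ eq → linear 2 (≡⇒≥ eq)
      (solve 2 (λ a b → a ⊕ con 1 ⊖ b := a ⊖ (b ⊕ con 1) ⊕ con 2)
        refl (ht (v + + 1)) (ht v))) , (λ eq → linear 0 (≡⇒≥ eq)
          (solve 2 (λ a b → a ⊕ con 1 ⊖ b := a ⊖ (b ⊖ con 1) ⊕ con 0)
            refl (ht (v + + 1)) (ht v))) ]′ (unit v)

  -- An odd point is the middle of a lattice line, so the height is linear around it. The slope can
  -- change only at even points.
  straight : ∀ {v j} → v ≡ + 2 * j + + 1 → ht (v + + 1) + ht (v - + 1) ≡ + 2 * ht v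
  straight {v} {j} odd = linear≡
    (cong ht {v + + 1} {+ 2 * j + + 2} (linear≡ odd
        (solve 2 (λ a b → a ⊕ con 1 ⊖ (b ⊕ con 2) := a ⊖ (b ⊕ con 1)) refl v (+ 2 * j))) +≡
     cong ht {v - + 1} {+ 2 * j} (linear≡ odd
         (solve 2 (λ a b → a ⊖ con 1 ⊖ b := a ⊖ (b ⊕ con 1)) refl v (+ 2 * j))) +≡ line j +≡
     cong (λ w → + 2 * ht w) (sym odd))
      (solve 4 (λ a b c d → a ⊖ b := a ⊕ c ⊕ d ⊖ (c ⊕ d ⊕ b))
        refl (ht (v + + 1) + ht (v - + 1)) (+ 2 * ht v) (ht (+ 2 * j + + 2) + ht (+ 2 * j)) (+ 2 * ht (+ 2 * j + + 1)))

  fall≤n : ∀ v n → ht (v - + n) ≤ ht v + + n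
  fall≤n v zero    = ≡⇒≤ (linear≡ (cong ht {v - + zero} {v} (solve 1 (λ a → a ⊖ con 0 := a) refl v))
      (solve 2 (λ a b → a ⊖ (b ⊕ con 0) := a ⊖ b) refl (ht (v - + zero)) (ht v)))
  fall≤n v (suc n) = linear 0
    (fall≤1 (v - + suc n) +≤ fall≤n v n +≤ ≡⇒≤ (cong ht {v - + suc n + + 1} {v - + n}
        (solve 2 (λ a b → a ⊖ (con 1 ⊕ b) ⊕ con 1 := a ⊖ b) refl v (+ n))))
      (solve 5 (λ a b c d e → a ⊕ (con 1 ⊕ b) ⊖ c := d ⊕ con 1 ⊕ (a ⊕ b) ⊕ e ⊖ (c ⊕ e ⊕ d) ⊕ con 0)
        refl (ht v) (+ n) (ht (v - + suc n)) (ht (v - + suc n + + 1)) (ht (v - + n)))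

  quasi-ℕ : ∀ n v → ht (v + + n * (+ 2 * N)) ≡ ht v + + n * κ
  quasi-ℕ zero    v = linear≡ (cong ht {v + + zero * (+ 2 * N)} {v}
      (solve 2 (λ a b → a ⊕ con 0 ⊗ b := a) refl v (+ 2 * N)))
      (solve 3 (λ a b c → a ⊖ (b ⊕ con 0 ⊗ c) := a ⊖ b) refl (ht (v + + zero * (+ 2 * N))) (ht v) κ)
  quasi-ℕ (suc n) v = linear≡
    (cong ht {v + + suc n * (+ 2 * N)} {v + + n * (+ 2 * N) + + 2 * N}
        (solve 3 (λ a b c → a ⊕ (con 1 ⊕ b) ⊗ c := a ⊕ b ⊗ c ⊕ c) refl v (+ n) (+ 2 * N)) +≡
     quasi (v + + n * (+ 2 * N)) +≡ quasi-ℕ n v)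
      (solve 6 (λ a b c d e f → a ⊖ (b ⊕ (con 1 ⊕ c) ⊗ d) :=
          a ⊕ e ⊕ f ⊖ (e ⊕ (f ⊕ d) ⊕ (b ⊕ c ⊗ d)))
        refl (ht (v + + suc n * (+ 2 * N))) (ht v) (+ n) κ (ht (v + + n * (+ 2 * N) + + 2 * N)) (ht (v + + n * (+ 2 * N))))

  quasi* : ∀ K v → ht (v + K * (+ 2 * N)) ≡ ht v + K * κ
  quasi* (+ n)    v = quasi-ℕ n v
  quasi* -[1+ n ] v = quasi-neg (+ suc n) (quasi-ℕ (suc n))
    where
    quasi-neg : ∀ z → (∀ v → ht (v + z * (+ 2 * N)) ≡ ht v + z * κ) →
                ht (v + - z * (+ 2 * N)) ≡ ht v + - z * κ
    quasi-neg z eq = linear≡ (sym (eq (v + - z * (+ 2 * N))) +≡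
                              cong ht {v + - z * (+ 2 * N) + z * (+ 2 * N)} {v}
                                  (solve 3 (λ a b c → a ⊕ ⊝ b ⊗ c ⊕ b ⊗ c := a) refl v z (+ 2 * N)))
        (solve 5 (λ a b c d e → a ⊖ (b ⊕ ⊝ c ⊗ d) := a ⊕ c ⊗ d ⊕ e ⊖ (e ⊕ b))
          refl (ht (v + - z * (+ 2 * N))) (ht v) z κ (ht (v + - z * (+ 2 * N) + z * (+ 2 * N))))

  -- This lets a quadrant be translated by whole periods together with its corner.
  passage-shift : ∀ {h S} K → Passage h S → Passage (h + K * κ) (S + K * (+ 2 * N))
  passage-shift {h} {S} K (value , before) =
    linear≡ (quasi* K S +≡ value)
        (solve 4 (λ a b c d → a ⊖ (b ⊕ c) := a ⊕ d ⊖ (d ⊕ c ⊕ b))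
          refl (ht (S + K * (+ 2 * N))) h (K * κ) (ht S)) ,
    λ i i<S → linear 0
      (before (i + - K * (+ 2 * N)) (linear 0 i<S
          (solve 4 (λ a b c d → a ⊖ (b ⊕ ⊝ c ⊗ d ⊕ con 1) := a ⊕ c ⊗ d ⊖ (b ⊕ con 1) ⊕ con 0)
            refl S i K (+ 2 * N))) +≤ ≡⇒≥ (quasi* (- K) i))
        (solve 5 (λ a b c d e → a ⊕ b ⊗ c ⊖ (d ⊕ con 1) :=
            a ⊕ e ⊖ (e ⊕ con 1 ⊕ (d ⊕ ⊝ b ⊗ c)) ⊕ con 0)
          refl h K κ (ht i) (ht (i + - K * (+ 2 * N))))

  module _ (1≤N : + 1 ≤ N) where

    1≤2N : + 1 ≤ + 2 * N
    1≤2N = linear 1 (1≤N +≤ 1≤N)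
        (solve 1 (λ a → con 2 ⊗ a ⊖ con 1 := a ⊕ a ⊖ (con 1 ⊕ con 1) ⊕ con 1) refl N)

    -- Moving `i` forward by whole periods until it is less than one period before `D` does not
    -- lower the height, because `0 ≤ κ`. The remaining distance is less than `2 * N`, and the
    -- height changes by at most one per step.
    ≤-back : + 0 ≤ κ → ∀ D i → i ≤ D → ht i ≤ ht D + + 2 * N
    ≤-back 0≤κ D i i≤D = go (divide 1≤2N (D - i))
      where
      go : (∃₂ λ r q → D - i ≡ r + q * (+ 2 * N) × + 0 ≤ r × r + + 1 ≤ + 2 * N) → ht i ≤ ht D + + 2 * N
      go (+ r , q , eq , _ , r<2N) = linear 1
        (0≤* 0≤q 0≤κ +≤ ≡⇒≥ (quasi* q i) +≤ fall≤n D r +≤ r<2N +≤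
         ≡⇒≤ (cong ht {i + q * (+ 2 * N)} {D - + r} (linear≡ (sym eq)
             (solve 4 (λ a b c d → a ⊕ b ⊖ (c ⊖ d) := d ⊕ b ⊖ (c ⊖ a))
               refl i (q * (+ 2 * N)) D (+ r)))))
          (solve 7 (λ a b c d e f g → a ⊕ b ⊖ c :=
              d ⊕ e ⊕ (a ⊕ f) ⊕ b ⊕ g ⊖ (con 0 ⊕ (c ⊕ d) ⊕ g ⊕ (f ⊕ con 1) ⊕ e) ⊕ con 1)
            refl (ht D) (+ 2 * N) (ht i) (q * κ) (ht (i + q * (+ 2 * N))) (+ r) (ht (D - + r)))
        where
        0≤q : + 0 ≤ q
        0≤q = case q <?≥ + 0 of λ where
          (inj₂ 0≤q) → 0≤q
          (inj₁ q<0) → ⊥-elim (absurd 0 (0≤* (ℤ.i≤j⇒0≤j-i q<0) (1≤⇒0≤ 1≤2N) +≤ r<2N +≤ i≤D +≤ ≡⇒≤ eq)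
              (solve 5 (λ a b c d e → (con 0 ⊖ (a ⊕ con 1)) ⊗ b ⊕ b ⊕ c ⊕ (d ⊕ a ⊗ b) ⊖ (con 0 ⊕ (d ⊕ con 1) ⊕ e ⊕ (c ⊖ e)) :=
                  ⊝ con 1) refl q (+ 2 * N) D (+ r) i))

    search : ∀ D h → (∀ i → i ≤ D → ht i + + 1 ≤ h) → ∀ n →
             (∀ i → i ≤ D + + n → ht i + + 1 ≤ h) ⊎ ∃ λ S → D + + 1 ≤ S × Passage h S
    search D h below zero    = inj₁ λ i i≤D → below i (linear 0 i≤D
        (solve 2 (λ a b → a ⊕ b := a ⊕ con 0 ⊕ b ⊕ con 0) refl D (- i)))
    search D h below (suc n) = case search D h below n of λ where
      (inj₂ found) → inj₂ found
      (inj₁ below′) → case ht (D + + suc n) <?≥ h of λ where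
        (inj₁ low) → inj₁ λ i i≤ → case i <?≥ D + + suc n of λ where
          (inj₁ i<) → below′ i (linear 0 i<
              (solve 3 (λ a b c → a ⊕ b ⊖ c := a ⊕ (con 1 ⊕ b) ⊖ (c ⊕ con 1) ⊕ con 0)
                refl D (+ n) i))
          (inj₂ ≤i) → linear 0 (low +≤ ≡⇒≤ (cong ht (ℤ.≤-antisym i≤ ≤i)))
              (solve 3 (λ a b c → a ⊖ (b ⊕ con 1) := a ⊕ c ⊖ (c ⊕ con 1 ⊕ b) ⊕ con 0)
                refl h (ht i) (ht (D + + suc n)))
        (inj₂ high) → inj₂ (D + + suc n , linear 0 (0≤+ n)
            (solve 2 (λ a b → a ⊕ (con 1 ⊕ b) ⊖ (a ⊕ con 1) := b ⊖ con 0 ⊕ con 0) refl D (+ n)) ,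
          -- The preceding point is below `h` and a step rises by at most one, so the first point
          -- that is not below `h` has height exactly `h`.
          ℤ.≤-antisym
            (linear 0 (rise≤1 (D + + n) +≤ below′ (D + + n) ℤ.≤-refl +≤
                       ≡⇒≤ (cong ht {D + + suc n} {D + + n + + 1}
                           (solve 2 (λ a b → a ⊕ (con 1 ⊕ b) := a ⊕ b ⊕ con 1) refl D (+ n))))
                (solve 4 (λ a b c d → a ⊖ b := c ⊕ a ⊕ d ⊖ (d ⊕ c ⊕ b) ⊕ con 0)
                  refl h (ht (D + + suc n)) (ht (D + + n) + + 1) (ht (D + + n + + 1))))
            high ,
          λ i i<S → below′ i (linear 0 i<S
              (solve 3 (λ a b c → a ⊕ b ⊖ c := a ⊕ (con 1 ⊕ b) ⊖ (c ⊕ con 1) ⊕ con 0)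
                refl D (+ n) i)))

    -- Each period gains at least one, so `m` periods with `h - ht D ≤ m` reach `h`. This bounds the
    -- search.
    first-passage : + 1 ≤ κ → ∀ D h → (∀ i → i ≤ D → ht i + + 1 ≤ h) →
                    ∃ λ S → D + + 1 ≤ S × Passage h S
    first-passage 1≤κ D h below = case archimedes (h - ht D) of λ where
      (m , h-D≤m) → let
        0≤m2N : + 0 ≤ + m * (+ 2 * N)
        0≤m2N = 0≤* {+ m} {+ 2 * N} (0≤+ m) (1≤⇒0≤ 1≤2N)
        in case search D h below ∣ + m * (+ 2 * N) ∣ of λ where
          (inj₂ found)  → found
          (inj₁ below′) → ⊥-elim (absurd 0
            (below′ (D + + m * (+ 2 * N)) (linear 0 (≡⇒≥ (ℤ.0≤i⇒+∣i∣≡i 0≤m2N))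
                (solve 3 (λ a b c → a ⊕ b ⊖ (a ⊕ c) := b ⊖ c ⊕ con 0)
                  refl D (+ ∣ + m * (+ 2 * N) ∣) (+ m * (+ 2 * N)))) +≤
             ≡⇒≥ (quasi* (+ m) D) +≤ 0≤* (0≤+ m) (ℤ.i≤j⇒0≤j-i 1≤κ) +≤ h-D≤m)
              (solve 5 (λ a b c d e → a ⊕ b ⊕ c ⊗ (d ⊖ con 1) ⊕ c ⊖ (b ⊕ con 1 ⊕ (e ⊕ c ⊗ d) ⊕ con 0 ⊕ (a ⊖ e)) :=
                  ⊝ con 1) refl h (ht (D + + m * (+ 2 * N))) (+ m) κ (ht D)))

    -- Going back `m` periods lowers the height by at least `m`; further to the left it can recover
    -- at most `2 * N`, by `≤-back`.
    eventually-below : + 1 ≤ κ → ∀ h → ∃ λ D → ∀ i → i ≤ D → ht i + + 1 ≤ h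
    eventually-below 1≤κ h = case archimedes (ht (+ 0) + + 2 * N + + 1 - h) of λ where
      (m , ≤m) → + 0 + - + m * (+ 2 * N) , λ i i≤D → linear 0
        (≤-back (1≤⇒0≤ 1≤κ) (+ 0 + - + m * (+ 2 * N)) i i≤D +≤ ≡⇒≤ (quasi* (- + m) (+ 0)) +≤
         0≤* (0≤+ m) (ℤ.i≤j⇒0≤j-i 1≤κ) +≤ ≤m)
          (solve 7 (λ a b c d e f g → a ⊖ (b ⊕ con 1) :=
              c ⊕ d ⊕ (e ⊕ ⊝ f ⊗ g) ⊕ f ⊗ (g ⊖ con 1) ⊕ f ⊖ (b ⊕ c ⊕ con 0 ⊕ (e ⊕ d ⊕ con 1 ⊖ a)) ⊕ con 0)
            refl h (ht i) (ht (+ 0 + - (+ m) * (+ 2 * N))) (+ 2 * N) (ht (+ 0)) (+ m) κ)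

    -- If the first passage to `h` is at an odd point, the profile is straight there and keeps
    -- rising for one more step. The next point is even and is the first passage to `h + 1`.
    even-passage : + 1 ≤ κ → ∀ D h → (∀ i → i ≤ D → ht i + + 1 ≤ h) →
                   ∃₂ λ h′ τ → h ≤ h′ × h′ ≤ h + + 1 × D + + 1 ≤ + 2 * τ × Passage h′ (+ 2 * τ)
    even-passage 1≤κ D h below = case first-passage 1≤κ D h below of λ where
      (S , D<S , passage@(value , before)) → case parity S of λ where
        (τ , inj₁ even) → h , τ , ℤ.≤-refl , linear 1 (ℤ.≤-refl {h})
            (solve 2 (λ a b → a ⊕ con 1 ⊕ b := a ⊕ b ⊕ con 1)
              refl h (- h)) , linear 0 (D<S +≤ ≡⇒≤ even)
                (solve 3 (λ a b c → a ⊖ b := c ⊕ a ⊖ (b ⊕ c) ⊕ con 0) refl (+ 2 * τ) (D + + 1) S) ,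
          subst (Passage h) even passage
        (j , inj₂ odd) → h + + 1 , j + + 1 , linear 1 (ℤ.≤-refl {h})
            (solve 2 (λ a b → a ⊕ con 1 ⊕ b := a ⊕ b ⊕ con 1)
              refl h (- h)) , ℤ.≤-refl , linear 1 (D<S +≤ ≡⇒≤ odd)
                (solve 3 (λ a b c → con 2 ⊗ (a ⊕ con 1) ⊖ b :=
                    c ⊕ (con 2 ⊗ a ⊕ con 1) ⊖ (b ⊕ c) ⊕ con 1) refl j (D + + 1) S) ,
          ℤ.≤-antisym
            (linear 0 (rise≤1 S +≤ ≡⇒≤ value +≤ ≡⇒≤ (cong ht {+ 2 * (j + + 1)} {S + + 1} (linear≡ (sym odd)
                (solve 2 (λ a b → con 2 ⊗ (a ⊕ con 1) ⊖ (b ⊕ con 1) := con 2 ⊗ a ⊕ con 1 ⊖ b)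
                  refl j S))))
                (solve 4 (λ a b c d → a ⊕ con 1 ⊖ b := c ⊕ con 1 ⊕ a ⊕ d ⊖ (d ⊕ c ⊕ b) ⊕ con 0)
                  refl h (ht (+ 2 * (j + + 1))) (ht S) (ht (S + + 1))))
            (linear 0 (≡⇒≥ (straight {j = j} odd) +≤ before (S - + 1) (≡⇒≤
                (solve 1 (λ a → a ⊖ con 1 ⊕ con 1 := a) refl S)) +≤ ≡⇒≥ value +≤ ≡⇒≥ value +≤
                       ≡⇒≥ (cong ht {+ 2 * (j + + 1)} {S + + 1} (linear≡ (sym odd)
                           (solve 2 (λ a b → con 2 ⊗ (a ⊕ con 1) ⊖ (b ⊕ con 1) :=
                               con 2 ⊗ a ⊕ con 1 ⊖ b) refl j S))))
                (solve 5 (λ a b c d e → a ⊖ (b ⊕ con 1) :=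
                    c ⊕ d ⊕ b ⊕ e ⊕ e ⊕ a ⊖ (con 2 ⊗ e ⊕ (d ⊕ con 1) ⊕ b ⊕ b ⊕ c) ⊕ con 0)
                  refl (ht (+ 2 * (j + + 1))) h (ht (S + + 1)) (ht (S - + 1)) (ht S))) ,
          λ i i< → linear 0 (≤-passage passage i (linear 0 (i< +≤ ≡⇒≥ odd)
              (solve 3 (λ a b c → a ⊖ b :=
                  con 2 ⊗ (c ⊕ con 1) ⊕ a ⊖ (b ⊕ con 1 ⊕ (con 2 ⊗ c ⊕ con 1)) ⊕ con 0) refl S i j)))
              (solve 2 (λ a b → a ⊕ con 1 ⊖ (b ⊕ con 1) := a ⊖ b ⊕ con 0) refl h (ht i))

argmax : ∀ (f : ℤ → ℤ) n → ∃ λ t → ∀ i → + 0 ≤ i → i ≤ + n → f i ≤ f t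
argmax f zero    = + 0 , λ i 0≤i i≤0 → ≡⇒≤ (cong f (ℤ.≤-antisym i≤0 0≤i))
argmax f (suc n) = case argmax f n of λ where
  (t , max) → case ℤ.≤-total (f t) (f (+ suc n)) of λ where
    (inj₁ t≤) → + suc n , λ i 0≤i i≤ → case i <?≥ + suc n of λ where
      (inj₁ i<) → ℤ.≤-trans (max i 0≤i (linear 0 i<
          (solve 2 (λ a b → a ⊖ b := con 1 ⊕ a ⊖ (b ⊕ con 1) ⊕ con 0) refl (+ n) i))) t≤
      (inj₂ ≤i) → ≡⇒≤ (cong f (ℤ.≤-antisym i≤ ≤i))
    (inj₂ ≤t) → t , λ i 0≤i i≤ → case i <?≥ + suc n of λ where
      (inj₁ i<) → max i 0≤i (linear 0 i<
          (solve 2 (λ a b → a ⊖ b := con 1 ⊕ a ⊖ (b ⊕ con 1) ⊕ con 0) refl (+ n) i))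
      (inj₂ ≤i) → ℤ.≤-trans (≡⇒≤ (cong f (ℤ.≤-antisym i≤ ≤i))) ≤t

module _ {N : ℤ} (1≤N : + 1 ≤ N) (F : Profile N (+ 0)) where
  open Profile F

  -- With no gain the height is periodic, so a maximum over one period is global. At an odd point
  -- the profile is straight and one of the two neighbours is higher, so the maximum is at an even
  -- point.
  even-peak : ∃ λ τ → ∀ i → ht i ≤ ht (+ 2 * τ)
  even-peak = case archimedes (+ 2 * N) of λ where
    (n , 2N≤n) → case argmax ht n of λ where
     (t , max) → let
      peak : ∀ i → ht i ≤ ht t
      peak i = case divide (1≤2N 1≤N) i of λ where
        (r , q , eq , 0≤r , r<2N) → linear 0
          (max r 0≤r (linear 1 (r<2N +≤ 2N≤n)
              (solve 3 (λ a b c → a ⊖ b := c ⊕ a ⊖ (b ⊕ con 1 ⊕ c) ⊕ con 1)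
                refl (+ n) r (+ 2 * N))) +≤ ≡⇒≤ (quasi* q r) +≤ ≡⇒≤ (cong ht eq))
            (solve 5 (λ a b c d e → a ⊖ b := a ⊕ (c ⊕ d ⊗ con 0) ⊕ e ⊖ (c ⊕ e ⊕ b) ⊕ con 0)
              refl (ht t) (ht i) (ht r) q (ht (r + q * (+ 2 * N))))
      in case parity t of λ where
        (τ , inj₁ even) → τ , λ i → subst (λ s → ht i ≤ ht s) even (peak i)
        (j , inj₂ odd)  → ⊥-elim (case unit t of λ where
          (inj₁ up)   → absurd 0 (peak (t + + 1) +≤ ≡⇒≥ up)
              (solve 2 (λ a b → a ⊕ b ⊖ (b ⊕ (a ⊕ con 1)) := ⊝ con 1) refl (ht t) (ht (t + + 1)))
          (inj₂ down) → absurd 0 (peak (t - + 1) +≤ ≡⇒≥ (straight {j = j} odd) +≤ ≡⇒≤ down)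
              (solve 3 (λ a b c → a ⊕ (b ⊕ c) ⊕ (a ⊖ con 1) ⊖ (c ⊕ con 2 ⊗ a ⊕ b) := ⊝ con 1)
                refl (ht t) (ht (t + + 1)) (ht (t - + 1))))

-- Walks

open Profile

-- The compass point names the diagonal step of `(u , v)`. The heights `f` at `v` and `g` at `u`
-- both change by the product of the two coordinate changes.
data Move (u v f g u′ v′ f′ g′ : ℤ) : Set where
  NE : u′ ≡ u + + 1 → v′ ≡ v + + 1 → f′ ≡ f + + 1 → g′ ≡ g + + 1 → Move u v f g u′ v′ f′ g′
  NW : u′ ≡ u - + 1 → v′ ≡ v + + 1 → f′ ≡ f - + 1 → g′ ≡ g - + 1 → Move u v f g u′ v′ f′ g′
  SE : u′ ≡ u + + 1 → v′ ≡ v - + 1 → f′ ≡ f - + 1 → g′ ≡ g - + 1 → Move u v f g u′ v′ f′ g′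
  SW : u′ ≡ u - + 1 → v′ ≡ v - + 1 → f′ ≡ f + + 1 → g′ ≡ g + + 1 → Move u v f g u′ v′ f′ g′

-- The lift of a loop, run forever: each turn translates it by `a` and `b` periods. `odd` singles
-- out the midpoints of edges. `closing` expresses that the loop repeats no edge: points that agree
-- up to periods are a whole number `l` of turns apart, with the same `l` in both coordinates.
record Walk {N κ M μ} (F : Profile N κ) (G : Profile M μ) (a b : ℤ) : Set where
  field
    period   : ℕ
    u v      : ℕ → ℤ
    odd      : ∀ n → ∃ λ w → u n + v n ≡ + 2 * w + + 1
    move     : ∀ n → Move (u n) (v n) (ht F (v n)) (ht G (u n))
                          (u (suc n)) (v (suc n)) (ht F (v (suc n))) (ht G (u (suc n)))
    u-period : ∀ n → u (n ℕ.+ period) ≡ u n + a * (+ 2 * M)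
    v-period : ∀ n → v (n ℕ.+ period) ≡ v n + b * (+ 2 * N)
    closing  : ∀ m n α β → u m ≡ u n + α * (+ 2 * M) → v m ≡ v n + β * (+ 2 * N) →
               ∃ λ l → α ≡ l * a × β ≡ l * b

  u-rise : ∀ n → u (suc n) ≤ u n + + 1
  u-rise n = case move n of λ where
    (NE u′ _ _ _) → ≡⇒≤ u′
    (NW u′ _ _ _) → linear 2 (≡⇒≤ u′)
        (solve 2 (λ a b → a ⊕ con 1 ⊕ b := a ⊖ con 1 ⊕ b ⊕ con 2) refl (u n) (- u (suc n)))
    (SE u′ _ _ _) → ≡⇒≤ u′
    (SW u′ _ _ _) → linear 2 (≡⇒≤ u′)
        (solve 2 (λ a b → a ⊕ con 1 ⊕ b := a ⊖ con 1 ⊕ b ⊕ con 2) refl (u n) (- u (suc n)))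

  u-fall : ∀ n → u n ≤ u (suc n) + + 1
  u-fall n = case move n of λ where
    (NE u′ _ _ _) → linear 2 (≡⇒≥ u′)
        (solve 2 (λ a b → a ⊕ con 1 ⊖ b := a ⊖ (b ⊕ con 1) ⊕ con 2) refl (u (suc n)) (u n))
    (NW u′ _ _ _) → linear 0 (≡⇒≥ u′)
        (solve 2 (λ a b → a ⊕ con 1 ⊖ b := a ⊖ (b ⊖ con 1) ⊕ con 0) refl (u (suc n)) (u n))
    (SE u′ _ _ _) → linear 2 (≡⇒≥ u′)
        (solve 2 (λ a b → a ⊕ con 1 ⊖ b := a ⊖ (b ⊕ con 1) ⊕ con 2) refl (u (suc n)) (u n))
    (SW u′ _ _ _) → linear 0 (≡⇒≥ u′)
        (solve 2 (λ a b → a ⊕ con 1 ⊖ b := a ⊖ (b ⊖ con 1) ⊕ con 0) refl (u (suc n)) (u n))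

  v-rise : ∀ n → v (suc n) ≤ v n + + 1
  v-rise n = case move n of λ where
    (NE _ v′ _ _) → ≡⇒≤ v′
    (NW _ v′ _ _) → ≡⇒≤ v′
    (SE _ v′ _ _) → linear 2 (≡⇒≤ v′)
        (solve 2 (λ a b → a ⊕ con 1 ⊕ b := a ⊖ con 1 ⊕ b ⊕ con 2) refl (v n) (- v (suc n)))
    (SW _ v′ _ _) → linear 2 (≡⇒≤ v′)
        (solve 2 (λ a b → a ⊕ con 1 ⊕ b := a ⊖ con 1 ⊕ b ⊕ con 2) refl (v n) (- v (suc n)))

  v-fall : ∀ n → v n ≤ v (suc n) + + 1
  v-fall n = case move n of λ where
    (NE _ v′ _ _) → linear 2 (≡⇒≥ v′)
        (solve 2 (λ a b → a ⊕ con 1 ⊖ b := a ⊖ (b ⊕ con 1) ⊕ con 2) refl (v (suc n)) (v n))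
    (NW _ v′ _ _) → linear 2 (≡⇒≥ v′)
        (solve 2 (λ a b → a ⊕ con 1 ⊖ b := a ⊖ (b ⊕ con 1) ⊕ con 2) refl (v (suc n)) (v n))
    (SE _ v′ _ _) → linear 0 (≡⇒≥ v′)
        (solve 2 (λ a b → a ⊕ con 1 ⊖ b := a ⊖ (b ⊖ con 1) ⊕ con 0) refl (v (suc n)) (v n))
    (SW _ v′ _ _) → linear 0 (≡⇒≥ v′)
        (solve 2 (λ a b → a ⊕ con 1 ⊖ b := a ⊖ (b ⊖ con 1) ⊕ con 0) refl (v (suc n)) (v n))

  level : ℤ
  level = ht F (v 0) - ht G (u 0)

  conserved : ∀ n → ht F (v n) - ht G (u n) ≡ level
  conserved zero    = refl
  conserved (suc n) = trans (case move n of λ where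
    (NE _ _ f′ g′) → linear≡ (f′ +≡ sym g′)
        (solve 4 (λ a b c d → a ⊖ b ⊖ (c ⊖ d) := a ⊕ (d ⊕ con 1) ⊖ (c ⊕ con 1 ⊕ b))
          refl (ht F (v (suc n))) (ht G (u (suc n))) (ht F (v n)) (ht G (u n)))
    (NW _ _ f′ g′) → linear≡ (f′ +≡ sym g′)
        (solve 4 (λ a b c d → a ⊖ b ⊖ (c ⊖ d) := a ⊕ (d ⊖ con 1) ⊖ (c ⊖ con 1 ⊕ b))
          refl (ht F (v (suc n))) (ht G (u (suc n))) (ht F (v n)) (ht G (u n)))
    (SE _ _ f′ g′) → linear≡ (f′ +≡ sym g′)
        (solve 4 (λ a b c d → a ⊖ b ⊖ (c ⊖ d) := a ⊕ (d ⊖ con 1) ⊖ (c ⊖ con 1 ⊕ b))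
          refl (ht F (v (suc n))) (ht G (u (suc n))) (ht F (v n)) (ht G (u n)))
    (SW _ _ f′ g′) → linear≡ (f′ +≡ sym g′)
        (solve 4 (λ a b c d → a ⊖ b ⊖ (c ⊖ d) := a ⊕ (d ⊕ con 1) ⊖ (c ⊕ con 1 ⊕ b))
          refl (ht F (v (suc n))) (ht G (u (suc n))) (ht F (v n)) (ht G (u n)))) (conserved n)

  -- During one turn `F` gains `b * κ` and `G` gains `a * μ`, while their difference is conserved.
  -- Thus `(a , b)` is parallel to `(κ , μ)`.
  bκ≡aμ : b * κ ≡ a * μ
  bκ≡aμ = linear≡ (once-around +≡
    cong (ht F) {v 0 + b * (+ 2 * N)} {v period} (sym (v-period 0)) +≡ sym (quasi* F b (v 0)) +≡
    cong (ht G) {u period} {u 0 + a * (+ 2 * M)} (u-period 0) +≡ quasi* G a (u 0))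
      (solve 8 (λ a b c d e f g h → a ⊖ b :=
          c ⊖ d ⊕ e ⊕ (f ⊕ a) ⊕ d ⊕ g ⊖ (f ⊖ h ⊕ c ⊕ e ⊕ g ⊕ (h ⊕ b)))
        refl (b * κ) (a * μ) (ht F (v period)) (ht G (u period)) (ht F (v 0 + b * (+ 2 * N))) (ht F (v 0)) (ht G (u 0 + a * (+ 2 * M))) (ht G (u 0)))
    where
    once-around : ht F (v period) - ht G (u period) ≡ ht F (v 0) - ht G (u 0)
    once-around = conserved period

  revolve : ∀ k → ∃ λ n → u n ≡ u 0 + + k * (a * (+ 2 * M)) × v n ≡ v 0 + + k * (b * (+ 2 * N))
  revolve zero    = 0 , (solve 2 (λ a b → a := a ⊕ con 0 ⊗ b) refl (u 0) (a * (+ 2 * M))) ,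
      (solve 2 (λ a b → a := a ⊕ con 0 ⊗ b) refl (v 0) (b * (+ 2 * N)))
  revolve (suc k) = case revolve k of λ where
    (n , un , vn) → n ℕ.+ period , linear≡ (u-period n +≡ un)
        (solve 5 (λ a b c d e → a ⊖ (b ⊕ (con 1 ⊕ c) ⊗ d) := a ⊕ e ⊖ (e ⊕ d ⊕ (b ⊕ c ⊗ d)))
          refl (u (n ℕ.+ period)) (u 0) (+ k) (a * (+ 2 * M)) (u n)) , linear≡ (v-period n +≡ vn)
            (solve 5 (λ a b c d e → a ⊖ (b ⊕ (con 1 ⊕ c) ⊗ d) := a ⊕ e ⊖ (e ⊕ d ⊕ (b ⊕ c ⊗ d)))
              refl (v (n ℕ.+ period)) (v 0) (+ k) (b * (+ 2 * N)) (v n))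

  column-odd : ∀ n {τ} → v n ≡ + 2 * τ → ∃ λ j → u n ≡ + 2 * j + + 1
  column-odd n {τ} vn = case odd n of λ where
    (w , uv) → w - τ , linear≡ (uv +≡ sym vn)
        (solve 4 (λ a b c d → a ⊖ (con 2 ⊗ (b ⊖ c) ⊕ con 1) :=
            a ⊕ d ⊕ con 2 ⊗ c ⊖ (con 2 ⊗ b ⊕ con 1 ⊕ d)) refl (u n) w τ (v n))

  -- A column crossed upwards has slope +1 on both sides, even when the
  -- walk reaches and leaves the crossing on the same side.
  up-slope : ∀ n {τ} → v n ≡ + 2 * τ → v n + + 1 ≤ v (suc n) →
             ht G (u n + + 1) ≡ ht G (u n) + + 1
  up-slope n vn v′> = case column-odd n vn of λ where
    (j , u-odd) → case move n of λ where
      (NE u′ _ _ g′) → linear≡ (cong (ht G) (sym u′) +≡ g′)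
          (solve 3 (λ a b c → a ⊖ b := a ⊕ c ⊖ (c ⊕ b))
            refl (ht G (u n + + 1)) (ht G (u n) + + 1) (ht G (u (suc n))))
      -- The step shows the slope on the left of the column's centre; `straight` carries it over to
      -- the right.
      (NW u′ _ _ g′) → linear≡
        (straight G {j = j} u-odd +≡ cong (ht G) u′ +≡ sym g′)
          (solve 4 (λ a b c d → a ⊖ (b ⊕ con 1) := a ⊕ c ⊕ d ⊕ (b ⊖ con 1) ⊖ (con 2 ⊗ b ⊕ c ⊕ d))
            refl (ht G (u n + + 1)) (ht G (u n)) (ht G (u n - + 1)) (ht G (u (suc n))))
      (SE _ v′ _ _) → ⊥-elim (absurd 1 (v′> +≤ ≡⇒≤ v′)
          (solve 2 (λ a b → a ⊕ (b ⊖ con 1) ⊖ (b ⊕ con 1 ⊕ a) := ⊝ con 2) refl (v (suc n)) (v n)))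
      (SW _ v′ _ _) → ⊥-elim (absurd 1 (v′> +≤ ≡⇒≤ v′)
          (solve 2 (λ a b → a ⊕ (b ⊖ con 1) ⊖ (b ⊕ con 1 ⊕ a) := ⊝ con 2) refl (v (suc n)) (v n)))

  -- The counterpart of `up-slope`, read at the point of arrival: a column crossed downwards has
  -- slope -1, so `G` is higher by one on its left side.
  down-slope : ∀ n {τ} → v (suc n) ≡ + 2 * τ → v (suc n) + + 1 ≤ v n →
               ht G (u (suc n) - + 1) ≡ ht G (u (suc n)) + + 1
  down-slope n v′≡ v> = case column-odd (suc n) v′≡ of λ where
    (j , u-odd) → case move n of λ where
      (NE _ v′ _ _) → ⊥-elim (absurd 1 (v> +≤ ≡⇒≥ v′)
          (solve 2 (λ a b → a ⊕ b ⊖ (b ⊕ con 1 ⊕ (a ⊕ con 1)) := ⊝ con 2) refl (v n) (v (suc n))))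
      (NW _ v′ _ _) → ⊥-elim (absurd 1 (v> +≤ ≡⇒≥ v′)
          (solve 2 (λ a b → a ⊕ b ⊖ (b ⊕ con 1 ⊕ (a ⊕ con 1)) := ⊝ con 2) refl (v n) (v (suc n))))
      (SE u′ _ _ g′) → linear≡
        (cong (ht G) {u (suc n) - + 1} {u n} (linear≡ u′
            (solve 2 (λ a b → a ⊖ con 1 ⊖ b := a ⊖ (b ⊕ con 1)) refl (u (suc n)) (u n))) +≡ sym g′)
          (solve 3 (λ a b c → a ⊖ (b ⊕ con 1) := a ⊕ (c ⊖ con 1) ⊖ (c ⊕ b))
            refl (ht G (u (suc n) - + 1)) (ht G (u (suc n))) (ht G (u n)))
      (SW u′ _ _ g′) → linear≡
        (straight G {j = j} u-odd +≡ g′ +≡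
         cong (ht G) {u n} {u (suc n) + + 1} (linear≡ (sym u′)
             (solve 2 (λ a b → a ⊖ (b ⊕ con 1) := a ⊖ con 1 ⊖ b) refl (u n) (u (suc n)))))
          (solve 4 (λ a b c d → a ⊖ (b ⊕ con 1) := c ⊕ a ⊕ b ⊕ d ⊖ (con 2 ⊗ b ⊕ (d ⊕ con 1) ⊕ c))
            refl (ht G (u (suc n) - + 1)) (ht G (u (suc n))) (ht G (u (suc n) + + 1)) (ht G (u n)))

  -- The quadrant {u < S, v ≤ 2τ} is never entered, and left only through
  -- its corner: elsewhere on its boundary the level is different.
  module Corner {h τ S} (top : Passage F h (+ 2 * τ)) (right : Passage G (h - level + + 1) S) where

    Inside : ℕ → Set
    Inside n = u n + + 1 ≤ S × v n ≤ + 2 * τ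

    -- On the wall `u = S`, `v ≤ 2τ` the difference of heights is at most
    -- `h - (h - level + 1) = level - 1`, so no walk of this level is ever there. This is the reason
    -- for the summand 1 in the height of `right`.
    off-wall : ∀ n → v n ≤ + 2 * τ → u n ≤ S → u n + + 1 ≤ S
    off-wall n v≤T u≤S = case u n <?≥ S of λ where
      (inj₁ u<S) → u<S
      (inj₂ S≤u) → ⊥-elim (absurd 0
        (≤-passage F top (v n) v≤T +≤ ≡⇒≥ (conserved n) +≤
         ≡⇒≥ (cong (ht G) (ℤ.≤-antisym u≤S S≤u)) +≤ ≡⇒≥ (proj₁ right))
          (solve 5 (λ a b c d e → a ⊕ (b ⊖ c) ⊕ c ⊕ d ⊖ (b ⊕ e ⊕ d ⊕ (a ⊖ e ⊕ con 1)) := ⊝ con 1)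
            refl h (ht F (v n)) (ht G (u n)) (ht G S) level))

    -- With the wall closed, the only way out is an upward step from `v = 2τ`, where `F` is `h` and
    -- `G` is `h - level`. By `up-slope`, `G` is `h - level + 1` at `u + 1`, and left of `S` this
    -- height is not reached; hence `u + 1 = S`.
    stay-or-exit : ∀ n → Inside n → Inside (suc n) ⊎ (u n ≡ S - + 1 × v n ≡ + 2 * τ)
    stay-or-exit n (u<S , v≤T) = case v (suc n) <?≥ + 2 * τ + + 1 of λ where
      (inj₁ v′<T+1) → let v′≤T = linear 0 v′<T+1
                                   (solve 2 (λ a b → a ⊖ b := a ⊕ con 1 ⊖ (b ⊕ con 1) ⊕ con 0)
                                     refl (+ 2 * τ) (v (suc n))) in
        inj₁ (off-wall (suc n) v′≤T (linear 0 (u<S +≤ u-rise n)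
            (solve 3 (λ a b c → a ⊖ b := a ⊕ c ⊖ (c ⊕ b) ⊕ con 0)
              refl S (u (suc n)) (u n + + 1))) , v′≤T)
      (inj₂ v′>T) → let
        vn : v n ≡ + 2 * τ
        vn = ℤ.≤-antisym v≤T (linear 0 (v′>T +≤ v-rise n)
            (solve 3 (λ a b c → a ⊖ b := c ⊕ (a ⊕ con 1) ⊖ (b ⊕ con 1 ⊕ c) ⊕ con 0)
              refl (v n) (+ 2 * τ) (v (suc n))))
        in inj₂ (ℤ.≤-antisym (linear 0 u<S
            (solve 2 (λ a b → a ⊖ con 1 ⊖ b := a ⊖ (b ⊕ con 1) ⊕ con 0)
              refl S (u n))) (case u n + + 1 <?≥ S - + 1 + + 1 of λ where
          (inj₂ S≤) → linear 0 S≤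
              (solve 2 (λ a b → a ⊖ b := a ⊕ con 1 ⊖ (b ⊕ con 1) ⊕ con 0) refl (u n) (S - + 1))
          (inj₁ <S) → ⊥-elim (absurd 0
            (proj₂ right (u n + + 1) (linear 0 <S
                (solve 2 (λ a b → a ⊕ b := a ⊖ con 1 ⊕ con 1 ⊕ b ⊕ con 0)
                  refl S (- (u n + + 1 + + 1)))) +≤ ≡⇒≥ (up-slope n vn (linear 0 (v′>T +≤ v≤T)
                    (solve 3 (λ a b c → a ⊖ (b ⊕ con 1) := a ⊕ c ⊖ (c ⊕ con 1 ⊕ b) ⊕ con 0)
                      refl (v (suc n)) (v n) (+ 2 * τ)))) +≤
             ≡⇒≤ (conserved n) +≤ ≡⇒≥ (cong (ht F) vn) +≤ ≡⇒≥ (proj₁ top))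
              (solve 6 (λ a b c d e f → a ⊖ b ⊕ con 1 ⊕ c ⊕ b ⊕ d ⊕ e ⊖ (c ⊕ con 1 ⊕ (f ⊕ con 1) ⊕ (d ⊖ f) ⊕ e ⊕ a) :=
                  ⊝ con 1)
                refl h level (ht G (u n + + 1)) (ht F (v n)) (ht F (+ 2 * τ)) (ht G (u n))))) , vn)

    -- An entry would be a downward step onto `v = 2τ`. By `down-slope`, `G` would be
    -- `h - level + 1` at a point to the left of the first passage `S` to that height.
    not-entered : ∀ n → Inside (suc n) → Inside n
    not-entered n (u′<S , v′≤T) = case v n <?≥ + 2 * τ + + 1 of λ where
      (inj₁ v<T+1) → let v≤T = linear 0 v<T+1
                                 (solve 2 (λ a b → a ⊖ b := a ⊕ con 1 ⊖ (b ⊕ con 1) ⊕ con 0)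
                                   refl (+ 2 * τ) (v n)) in
        off-wall n v≤T (linear 0 (u′<S +≤ u-fall n)
            (solve 3 (λ a b c → a ⊖ b := a ⊕ c ⊖ (c ⊕ b) ⊕ con 0)
              refl S (u n) (u (suc n) + + 1))) , v≤T
      (inj₂ v>T) → let
        v′n : v (suc n) ≡ + 2 * τ
        v′n = ℤ.≤-antisym v′≤T (linear 0 (v>T +≤ v-fall n)
            (solve 3 (λ a b c → a ⊖ b := c ⊕ (a ⊕ con 1) ⊖ (b ⊕ con 1 ⊕ c) ⊕ con 0)
              refl (v (suc n)) (+ 2 * τ) (v n)))
        in ⊥-elim (absurd 0
          (proj₂ right (u (suc n) - + 1) (linear 1 u′<S
              (solve 2 (λ a b → a ⊖ (b ⊖ con 1 ⊕ con 1) := a ⊖ (b ⊕ con 1) ⊕ con 1)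
                refl S (u (suc n)))) +≤
           ≡⇒≥ (down-slope n v′n (linear 0 (v>T +≤ v′≤T)
               (solve 3 (λ a b c → a ⊖ (b ⊕ con 1) := a ⊕ c ⊖ (c ⊕ con 1 ⊕ b) ⊕ con 0)
                 refl (v n) (v (suc n)) (+ 2 * τ)))) +≤ ≡⇒≤ (conserved (suc n)) +≤
           ≡⇒≥ (cong (ht F) v′n) +≤ ≡⇒≥ (proj₁ top))
            (solve 6 (λ a b c d e f → a ⊖ b ⊕ con 1 ⊕ c ⊕ b ⊕ d ⊕ e ⊖ (c ⊕ con 1 ⊕ (f ⊕ con 1) ⊕ (d ⊖ f) ⊕ e ⊕ a) :=
                ⊝ con 1)
              refl h level (ht G (u (suc n) - + 1)) (ht F (v (suc n))) (ht F (+ 2 * τ)) (ht G (u (suc n)))))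

    was-inside : ∀ n → Inside n → Inside 0
    was-inside zero    inside = inside
    was-inside (suc n) inside = was-inside n (not-entered n inside)

    inside-or-exited : ∀ n → Inside 0 → Inside n ⊎ ∃ λ m → u m ≡ S - + 1 × v m ≡ + 2 * τ
    inside-or-exited zero    inside = inj₁ inside
    inside-or-exited (suc n) inside = case inside-or-exited n inside of λ where
      (inj₁ insideₙ) → Sum.map₂ (n ,_) (stay-or-exit n insideₙ)
      (inj₂ exit)    → inj₂ exit

-- Two unbounded heights

module _ {N κ M μ : ℤ} {F : Profile N κ} {G : Profile M μ} {a b : ℤ}
         (1≤N : + 1 ≤ N) (1≤M : + 1 ≤ M) (1≤κ : + 1 ≤ κ) (1≤μ : + 1 ≤ μ) (W : Walk F G a b) where
  open Walk W

  a>0⇒b>0 : + 1 ≤ a → + 1 ≤ b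
  a>0⇒b>0 1≤a = case b <?≥ + 1 of λ where
    (inj₂ 1≤b) → 1≤b
    (inj₁ b<1) → ⊥-elim (absurd 0 (1≤* 1≤a 1≤μ +≤ ≡⇒≥ bκ≡aμ +≤
      0≤* (linear 0 {x = + 0} { - b} b<1
          (solve 1 (λ a → ⊝ a ⊖ con 0 := con 1 ⊖ (a ⊕ con 1) ⊕ con 0) refl b)) (1≤⇒0≤ 1≤κ))
        (solve 3 (λ a b c → a ⊕ b ⊗ c ⊕ ⊝ b ⊗ c ⊖ (con 1 ⊕ a ⊕ con 0) := ⊝ con 1) refl (a * μ) b κ))

  a<0⇒b<0 : a ≤ - + 1 → b ≤ - + 1
  a<0⇒b<0 a<0 = case - + 1 <?≥ b of λ where
    (inj₂ b<0) → b<0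
    (inj₁ b≥0) → ⊥-elim (absurd 0 (1≤* (linear 0 {x = + 1} { - a} a<0
        (solve 1 (λ a → a ⊖ con 1 := ⊝ con 1 ⊕ a ⊕ con 0) refl (- a))) 1≤μ +≤ ≡⇒≤ bκ≡aμ +≤
      0≤* (linear 0 {x = + 0} {b} b≥0
          (solve 1 (λ a → a ⊖ con 0 := a ⊖ (⊝ con 1 ⊕ con 1) ⊕ con 0) refl b)) (1≤⇒0≤ 1≤κ))
        (solve 3 (λ a b c → ⊝ a ⊗ b ⊕ a ⊗ b ⊕ c ⊖ (con 1 ⊕ c ⊕ con 0) := ⊝ con 1) refl a μ (b * κ)))

  a=0⇒b=0 : a ≡ + 0 → b ≡ + 0
  a=0⇒b=0 refl = ℤ.≤-antisym
    (case + 0 <?≥ b of λ where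
      (inj₂ b≤0) → b≤0
      (inj₁ b>0) → ⊥-elim (absurd 0 (1≤* (linear 0 {x = + 1} {b} b>0
          (solve 1 (λ a → a ⊖ con 1 := a ⊖ (con 0 ⊕ con 1) ⊕ con 0) refl b)) 1≤κ +≤ ≡⇒≤ bκ≡aμ)
          (solve 2 (λ a b → a ⊕ con 0 ⊗ b ⊖ (con 1 ⊕ a) := ⊝ con 1) refl (b * κ) μ)))
    (case b <?≥ + 0 of λ where
      (inj₂ b≥0) → b≥0
      (inj₁ b<0) → ⊥-elim (absurd 0 (1≤* (linear 0 {x = + 1} { - b} b<0
          (solve 1 (λ a → ⊝ a ⊖ con 1 := con 0 ⊖ (a ⊕ con 1) ⊕ con 0) refl b)) 1≤κ +≤ ≡⇒≥ bκ≡aμ)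
          (solve 3 (λ a b c → ⊝ a ⊗ b ⊕ a ⊗ b ⊖ (con 1 ⊕ con 0 ⊗ c) := ⊝ con 1) refl b κ μ)))

  -- A walk drifting to the lower left ends up in every quadrant. As quadrants are never entered, it
  -- must have started there; a quadrant chosen low enough does not contain the start.
  not-backwards : a ≤ - + 1 → b ≤ - + 1 → ⊥
  not-backwards a<0 b<0 =
    -- `even-passage` may add one to the height, so subtracting 2 keeps `h` below `ht F (v 0)`.
    case eventually-below F 1≤N 1≤κ (ht F (v 0) - + 2) of λ where
     (D , belowF) → case even-passage F 1≤N 1≤κ D (ht F (v 0) - + 2) belowF of λ where
      (h , τ , _ , h≤ , _ , top) → case eventually-below G 1≤M 1≤μ (h - level + + 1) of λ where
       (E , belowG) → case first-passage G 1≤M 1≤μ E (h - level + + 1) belowG of λ where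
        (S , _ , right) → case archimedes (u 0 + + 1 - S) of λ where
         (k , k≥) → case archimedes (v 0 - + 2 * τ) of λ where
          (l , l≥) → case revolve (k ℕ.+ l) of λ where
           (n , un , vn) → let
             inside : Corner.Inside top right n
             inside =
               linear 0 (≡⇒≤ un +≤ k≥ +≤ 0≤+ l +≤ descend a M (k ℕ.+ l) a<0 1≤M)
                   (solve 6 (λ a b c d e f → a ⊖ (b ⊕ con 1) :=
                       c ⊕ d ⊕ e ⊕ f ⊖ (e ⊕ f) ⊖ (b ⊕ (c ⊕ con 1 ⊖ a) ⊕ con 0 ⊕ d) ⊕ con 0)
                     refl S (u n) (u 0) ((+ k + + l) * (a * (+ 2 * M))) (+ k) (+ l)) ,
               linear 0 (≡⇒≤ vn +≤ l≥ +≤ 0≤+ k +≤ descend b N (k ℕ.+ l) b<0 1≤N)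
                   (solve 6 (λ a b c d e f → a ⊖ b :=
                       c ⊕ d ⊕ e ⊕ f ⊖ (f ⊕ e) ⊖ (b ⊕ (c ⊖ a) ⊕ con 0 ⊕ d) ⊕ con 0)
                     refl (+ 2 * τ) (v n) (v 0) ((+ k + + l) * (b * (+ 2 * N))) (+ l) (+ k))
             in absurd 0 (≤-passage F top (v 0) (proj₂ (Corner.was-inside top right n inside)) +≤ h≤)
                 (solve 2 (λ a b → a ⊕ (b ⊖ con 2 ⊕ con 1) ⊖ (b ⊕ a) := ⊝ con 1)
                   refl h (ht F (v 0)))
    where
    descend : ∀ c P k → c ≤ - + 1 → + 1 ≤ P → + k * (c * (+ 2 * P)) ≤ - + k
    descend c P k c<0 1≤P = linear 0
      (0≤* (0≤+ k) (0≤* (linear 0 {x = + 0} { - + 1 - c} c<0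
          (solve 1 (λ a → a ⊖ con 0 := a ⊕ con 0) refl (- + 1 - c))) (1≤⇒0≤ 1≤P)) +≤
       0≤* (0≤+ k) (0≤* (linear 0 {x = + 0} { - + 1 - c} c<0
           (solve 1 (λ a → a ⊖ con 0 := a ⊕ con 0) refl (- + 1 - c))) (1≤⇒0≤ 1≤P)) +≤
       0≤* (0≤+ k) (linear 0 {x = + 0} {P + P - + 1} (linear 1 {x = + 1} {P + P} (1≤P +≤ 1≤P)
           (solve 1 (λ a → a ⊖ con 1 := a ⊖ (con 1 ⊕ con 1) ⊕ con 1) refl (P + P)))
           (solve 1 (λ a → a ⊖ con 0 := a ⊕ con 0) refl (P + P - + 1))))
        (solve 3 (λ a b c → ⊝ a ⊖ a ⊗ (b ⊗ (con 2 ⊗ c)) :=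
            a ⊗ ((⊝ con 1 ⊖ b) ⊗ c) ⊕ a ⊗ ((⊝ con 1 ⊖ b) ⊗ c) ⊕ a ⊗ (c ⊕ c ⊖ con 1) ⊖ (con 0 ⊕ con 0 ⊕ con 0) ⊕ con 0)
          refl (+ k) c P)

  -- Rising above the top line means leaving the quadrant, and this happens only at the corner.
  outside : ∀ {h τ S} (top : Passage F h (+ 2 * τ)) (right : Passage G (h - level + + 1) S) →
            ∀ n → + 2 * τ + + 1 ≤ v n → Corner.Inside top right 0 →
            ∃ λ m → u m ≡ S - + 1 × v m ≡ + 2 * τ
  outside {τ = τ} top right n above inside = case Corner.inside-or-exited top right n inside of λ where
    (inj₁ (_ , v≤)) → ⊥-elim (absurd 0 (v≤ +≤ above)
        (solve 2 (λ a b → a ⊕ b ⊖ (b ⊕ (a ⊕ con 1)) := ⊝ con 1) refl (+ 2 * τ) (v n)))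
    (inj₂ exit)     → exit

  -- The walk starts inside a quadrant and inside its translate by `x` and `y` periods, and rises
  -- above both. It therefore visits both corners, and `closing` makes their difference a whole
  -- number of turns.
  multiple : + 1 ≤ b → ∀ x y → + 1 ≤ x → + 1 ≤ y → y * κ ≡ x * μ → ∃ λ l → x ≡ l * a × y ≡ l * b
  multiple 1≤b x y 1≤x 1≤y yκ≡xμ =
    -- By `≤-back` neither profile has reached its passage height at or before the start. This
    -- height thus places both `2τ` and `S` beyond the start, which is inside the quadrant.
    case even-passage F 1≤N 1≤κ (v 0) (ht F (v 0) + + 2 * N + + 2 * M + + 1)
           (λ i i≤ → linear 0 (≤-back F 1≤N (1≤⇒0≤ 1≤κ) (v 0) i i≤ +≤ 0≤M +≤ 0≤M)
               (solve 3 (λ a b c → a ⊕ con 2 ⊗ b ⊕ con 1 ⊖ (c ⊕ con 1) :=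
                   a ⊕ b ⊕ b ⊖ (c ⊕ con 0 ⊕ con 0) ⊕ con 0)
                 refl (ht F (v 0) + + 2 * N) M (ht F i))) of λ where
     (h , τ , ≤h , _ , v0<T , top) → case first-passage G 1≤M 1≤μ (u 0) (h - level + + 1)
           (λ i i≤ → linear 1 (≤-back G 1≤M (1≤⇒0≤ 1≤μ) (u 0) i i≤ +≤ ≤h +≤ ≡⇒≥ {ht F (v 0) - ht G (u 0)} {level} refl +≤ 0≤N +≤ 0≤N)
               (solve 7 (λ a b c d e f g → a ⊖ b ⊕ con 1 ⊖ (c ⊕ con 1) :=
                   d ⊕ e ⊕ a ⊕ (f ⊖ d) ⊕ g ⊕ g ⊖ (c ⊕ (f ⊕ con 2 ⊗ g ⊕ e ⊕ con 1) ⊕ b ⊕ con 0 ⊕ con 0) ⊕ con 1)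
                 refl h (Walk.level W) (ht G i) (ht G (u 0)) (+ 2 * M) (ht F (v 0)) N)) of λ where
      -- Enough turns to rise above the translated quadrant, and with it above the original one.
      (S , u0<S , right) → case archimedes (+ 2 * (τ + y * N) - v 0 + + 1) of λ where
       (k , k≥) → case revolve k of λ where
        (n , _ , vn) → let
          0≤xM = 0≤* (1≤⇒0≤ 1≤x) 0≤M
          0≤yN = 0≤* (1≤⇒0≤ 1≤y) 0≤N
          top′ : Passage F (h + y * κ) (+ 2 * (τ + y * N))
          top′ = subst (Passage F (h + y * κ))
              (solve 3 (λ a b c → con 2 ⊗ a ⊕ b ⊗ (con 2 ⊗ c) := con 2 ⊗ (a ⊕ b ⊗ c))
                refl τ y N) (passage-shift F y top)
          -- Since `(x , y)` is parallel to `(κ , μ)`, the passage heights of the translated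
          -- quadrant still match the level of the walk.
          level-shift : h - level + + 1 + x * μ ≡ h + y * κ - level + + 1
          level-shift = linear≡ (sym yκ≡xμ)
              (solve 4 (λ a b c d → a ⊕ b ⊕ con 1 ⊕ c ⊖ (a ⊕ d ⊕ b ⊕ con 1) := c ⊖ d)
                refl h (- level) (x * μ) (y * κ))
          right′ : Passage G (h + y * κ - level + + 1) (S + x * (+ 2 * M))
          right′ = subst (λ g → Passage G g (S + x * (+ 2 * M))) level-shift (passage-shift G x right)
          vn≥ : + 2 * (τ + y * N) + + 1 ≤ v n
          vn≥ = linear 0 (k≥ +≤ ≡⇒≥ vn +≤ 0≤* (0≤+ k) (0≤* (ℤ.i≤j⇒0≤j-i 1≤b) 0≤N)
                          +≤ 0≤* (0≤+ k) (0≤* (ℤ.i≤j⇒0≤j-i 1≤b) 0≤N)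
                          +≤ 0≤* (0≤+ k) (ℤ.i≤j⇒0≤j-i 1≤N) +≤ 0≤* (0≤+ k) 0≤N)
              (solve 6 (λ a b c d e f → a ⊖ (b ⊕ con 1) :=
                  c ⊕ a ⊕ c ⊗ ((d ⊖ con 1) ⊗ e) ⊕ c ⊗ ((d ⊖ con 1) ⊗ e) ⊕ c ⊗ (e ⊖ con 1) ⊕ c ⊗ e ⊖ (b ⊖ f ⊕ con 1 ⊕ (f ⊕ c ⊗ (d ⊗ (con 2 ⊗ e))) ⊕ con 0 ⊕ con 0 ⊕ con 0 ⊕ con 0) ⊕ con 0)
                refl (v n) (+ 2 * (τ + y * N)) (+ k) b N (v 0))
          in case outside top right n (linear 0 (vn≥ +≤ 0≤yN +≤ 0≤yN)
              (solve 3 (λ a b c → a ⊖ (con 2 ⊗ b ⊕ con 1) :=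
                  a ⊕ c ⊕ c ⊖ (con 2 ⊗ (b ⊕ c) ⊕ con 1 ⊕ con 0 ⊕ con 0) ⊕ con 0)
                refl (v n) τ (y * N))) (u0<S , linear 1 v0<T
                  (solve 2 (λ a b → a ⊖ b := a ⊖ (b ⊕ con 1) ⊕ con 1)
                    refl (+ 2 * τ) (v 0))) of λ where
           (m , um , vm) → case outside top′ right′ n vn≥
               (linear 0 (u0<S +≤ 0≤xM +≤ 0≤xM)
                   (solve 4 (λ a b c d → a ⊕ b ⊗ (con 2 ⊗ c) ⊖ d :=
                       a ⊕ b ⊗ c ⊕ b ⊗ c ⊖ (d ⊕ con 0 ⊕ con 0) ⊕ con 0)
                     refl S x M (u 0 + + 1)) , linear 1 (v0<T +≤ 0≤yN +≤ 0≤yN)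
                       (solve 3 (λ a b c → con 2 ⊗ (a ⊕ b) ⊖ c :=
                           con 2 ⊗ a ⊕ b ⊕ b ⊖ (c ⊕ con 1 ⊕ con 0 ⊕ con 0) ⊕ con 1)
                         refl τ (y * N) (v 0))) of λ where
             (m′ , um′ , vm′) → closing m′ m x y (linear≡ (um′ +≡ sym um)
                 (solve 4 (λ a b c d → a ⊖ (b ⊕ c) := a ⊕ (d ⊖ con 1) ⊖ (d ⊕ c ⊖ con 1 ⊕ b))
                   refl (u m′) (u m) (x * (+ 2 * M)) S)) (linear≡ (vm′ +≡ sym vm)
                     (solve 5 (λ a b c d e → a ⊖ (b ⊕ c ⊗ (con 2 ⊗ d)) :=
                         a ⊕ con 2 ⊗ e ⊖ (con 2 ⊗ (e ⊕ c ⊗ d) ⊕ b)) refl (v m′) (v m) y N τ))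
    where
    0≤M : + 0 ≤ M
    0≤M = 1≤⇒0≤ 1≤M
    0≤N : + 0 ≤ N
    0≤N = 1≤⇒0≤ 1≤N

  -- The common divisor `g` is left free: twice the gcd of `k x` and `k y` in the general case, and
  -- the gain itself for a symmetric pattern, where `(x , y)` becomes `(1 , 1)`.
  positive-quadrant : ¬ (a ≡ + 0 × b ≡ + 0) → ∀ x y g → + 1 ≤ g → κ ≡ x * g → μ ≡ y * g →
                      ∃ λ l → + 1 ≤ l × x ≡ l * a × y ≡ l * b
  positive-quadrant nontrivial x y g 1≤g κ≡ μ≡ = case a <?≥ + 0 of λ where
      (inj₁ a<0) → ⊥-elim (not-backwards (linear 0 a<0
          (solve 1 (λ a → ⊝ con 1 ⊖ a := con 0 ⊖ (a ⊕ con 1) ⊕ con 0)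
            refl a)) (a<0⇒b<0 (linear 0 a<0
              (solve 1 (λ a → ⊝ con 1 ⊖ a := con 0 ⊖ (a ⊕ con 1) ⊕ con 0) refl a))))
      (inj₂ a≥0) → case + 0 <?≥ a of λ where
        (inj₂ a≤0) → let a=0 = ℤ.≤-antisym a≤0 a≥0 in ⊥-elim (nontrivial (a=0 , a=0⇒b=0 a=0))
        (inj₁ a>0) → let
          1≤a = linear 0 {x = + 1} {a} a>0
              (solve 1 (λ a → a ⊖ con 1 := a ⊖ (con 0 ⊕ con 1) ⊕ con 0) refl a)
          1≤x = 1≤factor x 1≤κ κ≡
          in case multiple (a>0⇒b>0 1≤a) x y 1≤x (1≤factor y 1≤μ μ≡)
                    (linear≡ (cong (y *_) κ≡ +≡ cong (x *_) (sym μ≡))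
                        (solve 5 (λ a b c d e → a ⊖ b := a ⊕ c ⊗ (d ⊗ e) ⊖ (d ⊗ (c ⊗ e) ⊕ b))
                          refl (y * κ) (x * μ) x y g)) of λ where
            (l , x≡ , y≡) → l , (case l <?≥ + 1 of λ where
              (inj₂ 1≤l) → 1≤l
              (inj₁ l<1) → ⊥-elim (absurd 0 (1≤x +≤ ≡⇒≤ x≡ +≤
                0≤* (linear 0 {x = + 0} { - l} l<1
                    (solve 1 (λ a → ⊝ a ⊖ con 0 := con 1 ⊖ (a ⊕ con 1) ⊕ con 0)
                      refl l)) (1≤⇒0≤ 1≤a))
                  (solve 3 (λ a b c → a ⊕ b ⊗ c ⊕ ⊝ b ⊗ c ⊖ (con 1 ⊕ a ⊕ con 0) := ⊝ con 1)
                    refl x l a))) , x≡ , y≡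
    where
    1≤factor : ∀ z {π} → + 1 ≤ π → π ≡ z * g → + 1 ≤ z
    1≤factor z {π} 1≤π π≡ = case z <?≥ + 1 of λ where
      (inj₂ 1≤z) → 1≤z
      (inj₁ z<1) → ⊥-elim (absurd 0 (1≤π +≤ ≡⇒≤ π≡ +≤
        0≤* (linear 0 {x = + 0} { - z} z<1
            (solve 1 (λ a → ⊝ a ⊖ con 0 := con 1 ⊖ (a ⊕ con 1) ⊕ con 0) refl z)) (1≤⇒0≤ 1≤g))
          (solve 3 (λ a b c → a ⊕ b ⊗ c ⊕ ⊝ b ⊗ c ⊖ (con 1 ⊕ a ⊕ con 0) := ⊝ con 1) refl π z g))

-- A bounded height

module _ {N κ M μ : ℤ} {F : Profile N κ} {G : Profile M μ} {a b : ℤ} (W : Walk F G a b) where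
  open Walk W

  crossing : ∀ T n → v 0 ≤ T → T + + 1 ≤ v n → ∃ λ m → v m ≡ T × T + + 1 ≤ v (suc m)
  crossing T zero    v≤T v>T = ⊥-elim (absurd 0 (ℤ.≤-trans v>T v≤T)
      (solve 1 (λ a → a ⊖ (a ⊕ con 1) := ⊝ con 1) refl T))
  crossing T (suc n) v≤T v>T = case v n <?≥ T + + 1 of λ where
    (inj₁ vn≤T) → n , ℤ.≤-antisym (linear 0 vn≤T
        (solve 2 (λ a b → a ⊖ b := a ⊕ con 1 ⊖ (b ⊕ con 1) ⊕ con 0)
          refl T (v n))) (linear 0 (v>T +≤ v-rise n)
            (solve 3 (λ a b c → a ⊖ b := c ⊕ (a ⊕ con 1) ⊖ (b ⊕ con 1 ⊕ c) ⊕ con 0)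
              refl (v n) T (v (suc n)))) , v>T
    (inj₂ vn>T) → crossing T n v≤T vn>T

  module _ {w : ℤ} (wall : ∀ n → u n ≢ w) where

    beside : ∀ n → u n ≤ w → u n + + 1 ≤ w
    beside n u≤w = case u n <?≥ w of λ where
      (inj₁ u<w) → u<w
      (inj₂ w≤u) → ⊥-elim (wall n (ℤ.≤-antisym u≤w w≤u))

    side-from-0 : ∀ n → u 0 + + 1 ≤ w → u n + + 1 ≤ w
    side-from-0 zero    u<w = u<w
    side-from-0 (suc n) u<w = beside (suc n) (linear 0 (side-from-0 n u<w +≤ u-rise n)
        (solve 3 (λ a b c → a ⊖ b := a ⊕ c ⊖ (c ⊕ b) ⊕ con 0) refl w (u (suc n)) (u n + + 1)))

    side-to-0 : ∀ n → u n + + 1 ≤ w → u 0 + + 1 ≤ w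
    side-to-0 zero    u<w = u<w
    side-to-0 (suc n) u<w = side-to-0 n (beside n (linear 0 (u<w +≤ u-fall n)
        (solve 3 (λ a b c → a ⊖ b := a ⊕ c ⊖ (c ⊕ b) ⊕ con 0) refl w (u n) (u (suc n) + + 1))))

    -- Unit steps cannot jump over the column `w`. Passing through time 0 allows `m` and `n` in
    -- either order.
    same-side : ∀ m n → u m + + 1 ≤ w → u n + + 1 ≤ w
    same-side m n u<w = side-from-0 n (side-to-0 m u<w)

-- At the height of a highest row of F, an upward crossing leaves to its right
-- a column that the walk can never visit.  Hence all upward crossings of the
-- translates of that row happen in one column.
module _ {N M μ : ℤ} {F : Profile N (+ 0)} {G : Profile M μ} {a b : ℤ}
         (1≤N : + 1 ≤ N) (1≤b : + 1 ≤ b) (W : Walk F G a b) where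
  open Walk W

  peak-wall : ∀ {τ} → (∀ i → ht F i ≤ ht F (+ 2 * τ)) → ∀ m → v m ≡ + 2 * τ →
              + 2 * τ + + 1 ≤ v (suc m) → ∀ n → u n ≢ u m + + 1
  -- On that column `G` is one above its value at the crossing, so conservation would put `F` one
  -- above its maximum.
  peak-wall {τ} peak m vm v′> n un = absurd 0
    (peak (v n) +≤ ≡⇒≥ (conserved n) +≤ ≡⇒≤ (conserved m) +≤ ≡⇒≥ (cong (ht F) vm) +≤
     ≡⇒≥ (up-slope m {τ} vm (linear 0 (v′> +≤ ≡⇒≤ vm)
         (solve 3 (λ a b c → a ⊖ (b ⊕ con 1) := a ⊕ c ⊖ (c ⊕ con 1 ⊕ b) ⊕ con 0)
           refl (v (suc m)) (v m) (+ 2 * τ)))) +≤ ≡⇒≥ (cong (ht G) un))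
      (solve 7 (λ a b c d e f g → a ⊕ (b ⊖ c) ⊕ d ⊕ e ⊕ f ⊕ c ⊖ (b ⊕ d ⊕ (e ⊖ g) ⊕ a ⊕ (g ⊕ con 1) ⊕ f) :=
          ⊝ con 1)
        refl (ht F (+ 2 * τ)) (ht F (v n)) (ht G (u n)) (Walk.level W) (ht F (v m)) (ht G (u m + + 1)) (ht G (u m)))

  upward : a ≡ + 0 × b ≡ + 1
  upward =
    case even-peak 1≤N F of λ where
     -- `k` periods lift the peak row to the start or above it, and `l` turns bring the walk above
     -- the next translate of that row.
     (τ₀ , peak₀) → case archimedes (v 0 - + 2 * τ₀) of λ where
      (k , k≥) → case archimedes (+ 2 * (τ₀ + + k * N + N) + + 1 - v 0) of λ where
       (l , l≥) → case revolve l of λ where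
        (n , _ , vn) → let
          peak : ∀ j i → ht F i ≤ ht F (+ 2 * (τ₀ + j * N))
          peak j i = linear 0 (peak₀ i +≤ ≡⇒≥ (quasi* F j (+ 2 * τ₀)) +≤
            ≡⇒≤ (cong (ht F) {+ 2 * τ₀ + j * (+ 2 * N)} {+ 2 * (τ₀ + j * N)}
                (solve 3 (λ a b c → con 2 ⊗ a ⊕ b ⊗ (con 2 ⊗ c) := con 2 ⊗ (a ⊕ b ⊗ c))
                  refl τ₀ j N)))
              (solve 5 (λ a b c d e → a ⊖ b := c ⊕ d ⊕ a ⊖ (b ⊕ (c ⊕ e ⊗ con 0) ⊕ d) ⊕ con 0)
                refl (ht F (+ 2 * (τ₀ + j * N))) (ht F i) (ht F (+ 2 * τ₀)) (ht F (+ 2 * τ₀ + j * (+ 2 * N))) j)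
          peak′ : ∀ i → ht F i ≤ ht F (+ 2 * (τ₀ + + k * N + N))
          peak′ i = subst (λ t → ht F i ≤ ht F (+ 2 * t))
              (solve 3 (λ a b c → a ⊕ (b ⊕ con 1) ⊗ c := a ⊕ b ⊗ c ⊕ c)
                refl τ₀ (+ k) N) (peak (+ k + + 1) i)
          0≤N = 1≤⇒0≤ 1≤N
          0≤kN = 0≤* (0≤+ k) (ℤ.i≤j⇒0≤j-i 1≤N)
          vn≥ : + 2 * (τ₀ + + k * N + N) + + 1 ≤ v n
          vn≥ = linear 0 (l≥ +≤ ≡⇒≥ vn +≤ 0≤* (0≤+ l) (0≤* (ℤ.i≤j⇒0≤j-i 1≤b) 0≤N)
                          +≤ 0≤* (0≤+ l) (0≤* (ℤ.i≤j⇒0≤j-i 1≤b) 0≤N)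
                          +≤ 0≤* (0≤+ l) (ℤ.i≤j⇒0≤j-i 1≤N) +≤ 0≤* (0≤+ l) 0≤N)
              (solve 6 (λ a b c d e f → a ⊖ b :=
                  c ⊕ a ⊕ c ⊗ ((d ⊖ con 1) ⊗ e) ⊕ c ⊗ ((d ⊖ con 1) ⊗ e) ⊕ c ⊗ (e ⊖ con 1) ⊕ c ⊗ e ⊖ (b ⊖ f ⊕ (f ⊕ c ⊗ (d ⊗ (con 2 ⊗ e))) ⊕ con 0 ⊕ con 0 ⊕ con 0 ⊕ con 0) ⊕ con 0)
                refl (v n) (+ 2 * (τ₀ + + k * N + N) + + 1) (+ l) b N (v 0))
          v0≤T : v 0 ≤ + 2 * (τ₀ + + k * N)
          v0≤T = linear 0 (k≥ +≤ 0≤kN +≤ 0≤kN +≤ 0≤+ k)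
              (solve 4 (λ a b c d → con 2 ⊗ (a ⊕ b ⊗ c) ⊖ d :=
                  b ⊕ b ⊗ (c ⊖ con 1) ⊕ b ⊗ (c ⊖ con 1) ⊕ b ⊖ (d ⊖ con 2 ⊗ a ⊕ con 0 ⊕ con 0 ⊕ con 0) ⊕ con 0)
                refl τ₀ (+ k) N (v 0))
          in case crossing W (+ 2 * (τ₀ + + k * N)) n v0≤T (linear 0 (vn≥ +≤ 0≤N +≤ 0≤N)
              (solve 3 (λ a b c → a ⊖ (con 2 ⊗ b ⊕ con 1) :=
                  a ⊕ c ⊕ c ⊖ (con 2 ⊗ (b ⊕ c) ⊕ con 1 ⊕ con 0 ⊕ con 0) ⊕ con 0)
                refl (v n) (τ₀ + + k * N) N)) of λ where
           (m , vm , v>) → case crossing W (+ 2 * (τ₀ + + k * N + N)) n (linear 0 (v0≤T +≤ 0≤N +≤ 0≤N)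
               (solve 3 (λ a b c → con 2 ⊗ (a ⊕ b) ⊖ c :=
                   con 2 ⊗ a ⊕ b ⊕ b ⊖ (c ⊕ con 0 ⊕ con 0) ⊕ con 0)
                 refl (τ₀ + + k * N) N (v 0))) vn≥ of λ where
            (m′ , vm′ , v′>) → let
              -- Each crossing has a wall immediately to its right, and the other crossing lies to
              -- the left of that wall. The two bounds together force equal columns.
              um≡ : u m′ ≡ u m
              um≡ = ℤ.≤-antisym
                (linear 0 (same-side W (peak-wall {τ₀ + + k * N} (peak (+ k)) m vm v>) m m′ ℤ.≤-refl)
                    (solve 2 (λ a b → a ⊖ b := a ⊕ con 1 ⊖ (b ⊕ con 1) ⊕ con 0) refl (u m) (u m′)))
                (linear 0 (same-side W (peak-wall {τ₀ + + k * N + N} peak′ m′ vm′ v′>) m′ m ℤ.≤-refl)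
                    (solve 2 (λ a b → a ⊖ b := a ⊕ con 1 ⊖ (b ⊕ con 1) ⊕ con 0) refl (u m′) (u m)))
              -- One vertical period is thus `c` whole turns. Then `1 = c * b` with `b` positive
              -- gives `c = 1`.
              in case closing m′ m (+ 0) (+ 1) (linear≡ um≡
                  (solve 3 (λ a b c → a ⊖ (b ⊕ con 0 ⊗ c) := a ⊖ b)
                    refl (u m′) (u m) (+ 2 * M))) (linear≡ (vm′ +≡ sym vm)
                      (solve 4 (λ a b c d → a ⊖ (b ⊕ con 1 ⊗ (con 2 ⊗ c)) :=
                          a ⊕ con 2 ⊗ d ⊖ (con 2 ⊗ (d ⊕ c) ⊕ b))
                        refl (v m′) (v m) N (τ₀ + + k * N))) of λ where
                (c , 0≡ca , 1≡cb) → conclude c 0≡ca 1≡cb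
    where
    conclude : ∀ c → + 0 ≡ c * a → + 1 ≡ c * b → a ≡ + 0 × b ≡ + 1
    conclude c 0≡ca 1≡cb = (case c=1 of λ where
      refl → linear≡ (sym 0≡ca) (solve 1 (λ a → a ⊖ con 0 := con 1 ⊗ a ⊖ con 0)
                                  refl a) , linear≡ (sym 1≡cb)
          (solve 1 (λ a → a ⊖ con 1 := con 1 ⊗ a ⊖ con 1) refl b))
      where
      c=1 : c ≡ + 1
      c=1 = unit-factor 1≤b (linear≡ 1≡cb
          (solve 2 (λ a b → con 1 ⊖ a ⊗ b := con 1 ⊖ b ⊗ a) refl b c))

-- Symmetries

neg-suc : ∀ i {j} → j ≡ i + + 1 → - j ≡ - i - + 1
neg-suc i refl = solve 1 (λ a → ⊝ (a ⊕ con 1) := ⊝ a ⊖ con 1) refl i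

neg-pred : ∀ i {j} → j ≡ i - + 1 → - j ≡ - i + + 1
neg-pred i refl = solve 1 (λ a → ⊝ (a ⊖ con 1) := ⊝ a ⊕ con 1) refl i

negate : ∀ {N κ} → Profile N κ → Profile N (- κ)
negate {N} {κ} F = record
  { ht    = λ v → - ht F v
  ; unit  = λ v → Sum.swap (Sum.map (neg-suc (ht F v)) (neg-pred (ht F v)) (unit F v))
  ; line  = λ j → linear≡ (cong -_ (line F j))
      (solve 3 (λ a b c → ⊝ a ⊖ b ⊖ con 2 ⊗ ⊝ c := ⊝ (a ⊕ b) ⊖ ⊝ (con 2 ⊗ c))
        refl (ht F (+ 2 * j + + 2)) (ht F (+ 2 * j)) (ht F (+ 2 * j + + 1)))
  ; quasi = λ v → linear≡ (cong -_ (quasi F v))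
      (solve 3 (λ a b c → a ⊖ (⊝ b ⊖ c) := a ⊖ ⊝ (b ⊕ c)) refl (- ht F (v + + 2 * N)) (ht F v) κ)
  }

-- The graph turned by 180 degrees about the origin. Its slopes are the old ones in reverse order,
-- so the gain is unchanged.
rotate : ∀ {N κ} → Profile N κ → Profile N κ
rotate {N} {κ} F = record
  { ht    = λ v → - ht F (- v)
  ; unit  = λ v → let
      next = cong (ht F) { - (v + + 1) + + 1} { - v} (solve 1 (λ a → ⊝ (a ⊕ con 1) ⊕ con 1 := ⊝ a)
                                                       refl v)
      in Sum.map
        (λ up → linear≡ (up +≡ sym next)
          (solve 3 (λ a b c → ⊝ a ⊖ (⊝ b ⊕ con 1) := c ⊕ b ⊖ (a ⊕ con 1 ⊕ c)) refl
            (ht F (- (v + + 1))) (ht F (- v)) (ht F (- (v + + 1) + + 1))))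
        (λ down → linear≡ (down +≡ sym next)
          (solve 3 (λ a b c → ⊝ a ⊖ (⊝ b ⊖ con 1) := c ⊕ b ⊖ (a ⊖ con 1 ⊕ c)) refl
            (ht F (- (v + + 1))) (ht F (- v)) (ht F (- (v + + 1) + + 1))))
        (unit F (- (v + + 1)))
  ; line  = λ j → linear≡ (cong -_ (line F (- j - + 1)) +≡
      cong (ht F) {+ 2 * (- j - + 1) + + 2} { - (+ 2 * j)}
          (solve 1 (λ a → con 2 ⊗ (⊝ a ⊖ con 1) ⊕ con 2 := ⊝ (con 2 ⊗ a)) refl j) +≡
      cong (ht F) {+ 2 * (- j - + 1)} { - (+ 2 * j + + 2)}
          (solve 1 (λ a → con 2 ⊗ (⊝ a ⊖ con 1) := ⊝ (con 2 ⊗ a ⊕ con 2)) refl j) +≡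
      cong (λ w → + 2 * ht F w) { - (+ 2 * j + + 1)} {+ 2 * (- j - + 1) + + 1}
          (solve 1 (λ a → ⊝ (con 2 ⊗ a ⊕ con 1) := con 2 ⊗ (⊝ a ⊖ con 1) ⊕ con 1) refl j))
      (solve 6 (λ a b c d e f → ⊝ a ⊖ b ⊖ con 2 ⊗ ⊝ c :=
          ⊝ (d ⊕ e) ⊕ d ⊕ e ⊕ con 2 ⊗ c ⊖ (⊝ f ⊕ b ⊕ a ⊕ f))
        refl (ht F (- (+ 2 * j + + 2))) (ht F (- (+ 2 * j))) (ht F (- (+ 2 * j + + 1))) (ht F (+ 2 * (- j - + 1) + + 2)) (ht F (+ 2 * (- j - + 1))) (+ 2 * ht F (+ 2 * (- j - + 1) + + 1)))
  ; quasi = λ v → linear≡ (quasi F (- (v + + 2 * N)) +≡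
      cong (ht F) { - v} { - (v + + 2 * N) + + 2 * N}
          (solve 2 (λ a b → ⊝ a := ⊝ (a ⊕ b) ⊕ b) refl v (+ 2 * N)))
      (solve 4 (λ a b c d → ⊝ a ⊖ (⊝ b ⊕ c) := d ⊕ b ⊖ (a ⊕ c ⊕ d))
        refl (ht F (- (v + + 2 * N))) (ht F (- v)) κ (ht F (- (v + + 2 * N) + + 2 * N)))
  }

flip : ∀ {u v f g u′ v′ f′ g′} → Move u v f g u′ v′ f′ g′ → Move v u g f v′ u′ g′ f′
flip (NE u′ v′ f′ g′) = NE v′ u′ g′ f′
flip (NW u′ v′ f′ g′) = SE v′ u′ g′ f′
flip (SE u′ v′ f′ g′) = NW v′ u′ g′ f′
flip (SW u′ v′ f′ g′) = SW v′ u′ g′ f′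

-- Reversing the horizontal change reverses the product of the two changes, so both heights are
-- negated.
mirror : ∀ {u v f g u′ v′ f′ g′} → Move u v f g u′ v′ f′ g′ →
         Move (- u) v (- f) (- g) (- u′) v′ (- f′) (- g′)
mirror {u} {v} {f} {g} = λ where
  (NE u′ v′ f′ g′) → NW (neg-suc u u′)  v′ (neg-suc f f′)  (neg-suc g g′)
  (NW u′ v′ f′ g′) → NE (neg-pred u u′) v′ (neg-pred f f′) (neg-pred g g′)
  (SE u′ v′ f′ g′) → SW (neg-suc u u′)  v′ (neg-pred f f′) (neg-pred g g′)
  (SW u′ v′ f′ g′) → SE (neg-pred u u′) v′ (neg-suc f f′)  (neg-suc g g′)

module _ {N κ M μ : ℤ} {F : Profile N κ} {G : Profile M μ} {a b : ℤ} (W : Walk F G a b) where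
  open Walk W

  swap : Walk G F b a
  swap = record
    { period   = period
    ; u        = v
    ; v        = u
    ; odd      = λ n → case odd n of λ where
        (w , uv) → w , linear≡ uv
          (solve 3 (λ a b c → a ⊕ b ⊕ c := b ⊕ a ⊕ c) refl (v n) (u n) (- (+ 2 * w + + 1)))
    ; move     = λ n → flip (move n)
    ; u-period = v-period
    ; v-period = u-period
    ; closing  = λ m n α β um vm → case closing m n β α vm um of λ where
        (l , β≡ , α≡) → l , α≡ , β≡
    }

  -- Both heights are negated, as in `mirror`. `G` is also read at the negated argument, so it
  -- becomes `rotate G` and keeps `μ`, while `κ` and `a` change sign.
  reflect-u : Walk (negate F) (rotate G) (- a) b
  reflect-u = record
    { period   = period
    ; u        = λ n → - u n
    ; v        = v
    ; odd      = λ n → case odd n of λ where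
        (w , uv) → w - u n , linear≡ uv
          (solve 3 (λ a b c → ⊝ a ⊕ b ⊖ (con 2 ⊗ (c ⊖ a) ⊕ con 1) := a ⊕ b ⊖ (con 2 ⊗ c ⊕ con 1))
            refl (u n) (v n) w)
    ; move     = λ n → subst₂
        (λ w w′ → Move (- u n) (v n) (- ht F (v n)) (- ht G w)
                       (- u (suc n)) (v (suc n)) (- ht F (v (suc n))) (- ht G w′))
        (sym (ℤ.neg-involutive (u n))) (sym (ℤ.neg-involutive (u (suc n)))) (mirror (move n))
    ; u-period = λ n → linear≡ (cong -_ (u-period n))
        (solve 4 (λ a b c d → a ⊖ (⊝ b ⊕ ⊝ c ⊗ d) := a ⊖ ⊝ (b ⊕ c ⊗ d))
          refl (- u (n ℕ.+ period)) (u n) a (+ 2 * M))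
    ; v-period = v-period
    ; closing  = λ m n α β um vm → case closing m n (- α) β (linear≡ (cong -_ um)
        (solve 4 (λ a b c d → a ⊖ (b ⊕ ⊝ c ⊗ d) := ⊝ (⊝ a) ⊖ ⊝ (⊝ b ⊕ c ⊗ d))
          refl (u m) (u n) α (+ 2 * M))) vm of λ where
        (l , α≡ , β≡) → l , linear≡ (cong -_ α≡)
            (solve 3 (λ a b c → a ⊖ b ⊗ ⊝ c := ⊝ (⊝ a) ⊖ ⊝ (b ⊗ c)) refl α l a) , β≡
    }

module _ {N κ M μ : ℤ} {F : Profile N κ} {G : Profile M μ} {a b : ℤ} where

  reflect-v : Walk F G a b → Walk (rotate F) (negate G) a (- b)
  reflect-v W = swap (reflect-u (swap W))

neg-≡0 : ∀ {i} → - i ≡ + 0 → i ≡ + 0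
neg-≡0 {i} eq = linear≡ (cong -_ eq) (solve 1 (λ a → a ⊖ con 0 := ⊝ (⊝ a) ⊖ ⊝ con 0) refl i)

≢0-cases : ∀ {i} → i ≢ + 0 → + 1 ≤ i ⊎ + 1 ≤ - i
≢0-cases {i} i≢0 = case i <?≥ + 0 of λ where
  (inj₁ i<0) → inj₂ (linear 0 i<0
      (solve 1 (λ a → ⊝ a ⊖ con 1 := con 0 ⊖ (a ⊕ con 1) ⊕ con 0) refl i))
  (inj₂ i≥0) → case + 0 <?≥ i of λ where
    (inj₁ i>0) → inj₁ (linear 0 i>0
        (solve 1 (λ a → a ⊖ con 1 := a ⊖ (con 0 ⊕ con 1) ⊕ con 0) refl i))
    (inj₂ i≤0) → ⊥-elim (i≢0 (ℤ.≤-antisym i≤0 i≥0))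

module _ {N M : ℤ} (1≤N : + 1 ≤ N) (1≤M : + 1 ≤ M) where

  -- `reflect-u` reverses `κ` together with `a`, and `reflect-v` reverses `μ` together with `b`; the
  -- four sign patterns thus reduce to `positive-quadrant`.
  both-tilted : ∀ {κ μ} {F : Profile N κ} {G : Profile M μ} {a b} → κ ≢ + 0 → μ ≢ + 0 → Walk F G a b →
                ¬ (a ≡ + 0 × b ≡ + 0) → ∀ x y g → + 1 ≤ g → κ ≡ x * g → μ ≡ y * g →
                ∃ λ l → + 1 ≤ l × x ≡ l * a × y ≡ l * b
  both-tilted {κ} {μ} {G = G} {a = a} κ≢0 μ≢0 W nontrivial x y g 1≤g κ≡ μ≡ = case ≢0-cases κ≢0 of λ where
      (inj₁ κ>0) → right-half κ>0 W nontrivial x κ≡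
      (inj₂ κ<0) → case right-half κ<0 (reflect-u W)
          (λ (a≡0 , b≡0) → nontrivial (neg-≡0 a≡0 , b≡0)) (- x) (linear≡ (cong -_ κ≡)
              (solve 3 (λ a b c → a ⊖ ⊝ b ⊗ c := a ⊖ ⊝ (b ⊗ c)) refl (- κ) x g)) of λ where
        (l , 1≤l , x≡ , y≡) → l , 1≤l , linear≡ (cong -_ x≡)
            (solve 3 (λ a b c → a ⊖ b ⊗ c := ⊝ (⊝ a) ⊖ ⊝ (b ⊗ ⊝ c)) refl x l a) , y≡
    where
    right-half : ∀ {κ} {F : Profile N κ} {G : Profile M μ} {a b} → + 1 ≤ κ → Walk F G a b →
                 ¬ (a ≡ + 0 × b ≡ + 0) → ∀ x → κ ≡ x * g →
                 ∃ λ l → + 1 ≤ l × x ≡ l * a × y ≡ l * b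
    right-half {b = b} κ>0 W nontrivial x κ≡ = case ≢0-cases μ≢0 of λ where
      (inj₁ μ>0) → positive-quadrant 1≤N 1≤M κ>0 μ>0 W nontrivial x y g 1≤g κ≡ μ≡
      (inj₂ μ<0) → case positive-quadrant 1≤N 1≤M κ>0 μ<0 (reflect-v W)
          (λ (a≡0 , b≡0) → nontrivial (a≡0 , neg-≡0 b≡0)) x (- y) g 1≤g κ≡ (linear≡ (cong -_ μ≡)
              (solve 3 (λ a b c → a ⊖ ⊝ b ⊗ c := a ⊖ ⊝ (b ⊗ c)) refl (- μ) y g)) of λ where
        (l , 1≤l , x≡ , y≡) → l , 1≤l , x≡ , linear≡ (cong -_ y≡)
            (solve 3 (λ a b c → a ⊖ b ⊗ c := ⊝ (⊝ a) ⊖ ⊝ (b ⊗ ⊝ c)) refl y l b)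

module _ {N κ M μ : ℤ} {F : Profile N κ} {G : Profile M μ} {a b : ℤ} (1≤N : + 1 ≤ N) where

  -- A downward walk is reflected into an upward one; `rotate` leaves the vanishing gain of `F` as
  -- it is.
  level-rows : κ ≡ + 0 → Walk F G a b → b ≢ + 0 → a ≡ + 0 × (b ≡ + 1 ⊎ b ≡ - + 1)
  level-rows refl W b≢0 = case ≢0-cases b≢0 of λ where
    (inj₁ b>0) → case upward 1≤N b>0 W of λ where
      (a≡0 , b≡1) → a≡0 , inj₁ b≡1
    (inj₂ b<0) → case upward 1≤N b<0 (reflect-v W) of λ where
      (a≡0 , -b≡1) → a≡0 , inj₂ (linear≡ (cong -_ -b≡1)
          (solve 1 (λ a → a ⊖ ⊝ con 1 := ⊝ (⊝ a) ⊖ ⊝ con 1) refl b))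

module _ {N κ : ℤ} {F : Profile N κ} (1≤N : + 1 ≤ N) where

  module _ {a b : ℤ} (W : Walk F F a b) where
    open Walk W

    -- The translates of the diagonal u = v are never crossed.
    below-diagonal : ∀ K → u 0 + + 1 ≤ v 0 + K * (+ 2 * N) → ∀ n → u n + + 1 ≤ v n + K * (+ 2 * N)
    below-diagonal K below zero    = below
    below-diagonal K below (suc n) = let belowₙ = below-diagonal K below n in case move n of λ where
      (NE u′ v′ _ _) → linear 0 (belowₙ +≤ ≡⇒≤ u′ +≤ ≡⇒≥ v′)
          (solve 5 (λ a b c d e → a ⊕ b ⊖ (c ⊕ con 1) :=
              d ⊕ b ⊕ e ⊕ a ⊖ (e ⊕ c ⊕ (d ⊕ con 1)) ⊕ con 0)
            refl (v (suc n)) (K * (+ 2 * N)) (u (suc n)) (v n) (u n + + 1))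
      (NW u′ v′ _ _) → linear 2 (belowₙ +≤ ≡⇒≤ u′ +≤ ≡⇒≥ v′)
          (solve 5 (λ a b c d e → a ⊕ b ⊖ (c ⊕ con 1) :=
              d ⊕ b ⊕ (e ⊖ con 1) ⊕ a ⊖ (e ⊕ con 1 ⊕ c ⊕ (d ⊕ con 1)) ⊕ con 2)
            refl (v (suc n)) (K * (+ 2 * N)) (u (suc n)) (v n) (u n))
      (SW u′ v′ _ _) → linear 0 (belowₙ +≤ ≡⇒≤ u′ +≤ ≡⇒≥ v′)
          (solve 5 (λ a b c d e → a ⊕ b ⊖ (c ⊕ con 1) :=
              d ⊕ b ⊕ (e ⊖ con 1) ⊕ a ⊖ (e ⊕ con 1 ⊕ c ⊕ (d ⊖ con 1)) ⊕ con 0)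
            refl (v (suc n)) (K * (+ 2 * N)) (u (suc n)) (v n) (u n))
      -- Only this step approaches the diagonal. It cannot end on it, because `u + v` is odd. If it
      -- ended beyond, it would exchange `u` with the translated `v`, and `ht F` would fall by one
      -- both from `v n` to `v (suc n)` and back again.
      (SE u′ v′ f′ g′) → case u (suc n) <?≥ v (suc n) + K * (+ 2 * N) of λ where
        (inj₁ below′) → below′
        (inj₂ above) → ⊥-elim (case v (suc n) + K * (+ 2 * N) <?≥ u (suc n) of λ where
          (inj₂ on) → case odd (suc n) of λ where
            (w , uv) → even≢odd (v (suc n) + K * N) w (linear≡ (uv +≡ ℤ.≤-antisym above on)
                (solve 5 (λ a b c d e → con 2 ⊗ (a ⊕ b ⊗ c) ⊖ d :=
                    e ⊕ a ⊕ (a ⊕ b ⊗ (con 2 ⊗ c)) ⊖ (d ⊕ e))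
                  refl (v (suc n)) K N (+ 2 * w + + 1) (u (suc n))))
          (inj₁ over) → let
            u≡ : u n ≡ v (suc n) + K * (+ 2 * N)
            u≡ = ℤ.≤-antisym (linear 0 (belowₙ +≤ ≡⇒≥ v′)
                (solve 4 (λ a b c d → a ⊕ b ⊖ c := d ⊕ b ⊕ a ⊖ (c ⊕ con 1 ⊕ (d ⊖ con 1)) ⊕ con 0)
                  refl (v (suc n)) (K * (+ 2 * N)) (u n) (v n))) (linear 0 (over +≤ ≡⇒≤ u′)
                    (solve 3 (λ a b c → a ⊖ b := c ⊕ (a ⊕ con 1) ⊖ (b ⊕ con 1 ⊕ c) ⊕ con 0)
                      refl (u n) (v (suc n) + K * (+ 2 * N)) (u (suc n))))
            u′≡ : u (suc n) ≡ v n + K * (+ 2 * N)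
            u′≡ = linear≡ (u′ +≡ u≡ +≡ v′)
                (solve 5 (λ a b c d e → a ⊖ (b ⊕ c) :=
                    a ⊕ d ⊕ e ⊖ (d ⊕ con 1 ⊕ (e ⊕ c) ⊕ (b ⊖ con 1)))
                  refl (u (suc n)) (v n) (K * (+ 2 * N)) (u n) (v (suc n)))
            in absurd 1
              (≡⇒≥ (quasi* F K (v n)) +≤ ≡⇒≥ (cong (ht F) u′≡) +≤ ≡⇒≤ g′ +≤
               ≡⇒≤ (cong (ht F) u≡) +≤ ≡⇒≤ (quasi* F K (v (suc n))) +≤ ≡⇒≤ f′)
                (solve 7 (λ a b c d e f g → a ⊕ b ⊕ (c ⊖ con 1) ⊕ d ⊕ (e ⊕ f) ⊕ (g ⊖ con 1) ⊖ (g ⊕ f ⊕ a ⊕ b ⊕ c ⊕ d ⊕ e) :=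
                    ⊝ con 2)
                  refl (ht F (v n + K * (+ 2 * N))) (ht F (u (suc n))) (ht F (u n)) (ht F (v (suc n) + K * (+ 2 * N))) (ht F (v (suc n))) (K * κ) (ht F (v n))))

    -- If `b < a`, every turn moves the walk to the right relative to the diagonal, so it would
    -- eventually cross a translate that it started to the left of.
    a≤b : a ≤ b
    a≤b = case b <?≥ a of λ where
      (inj₂ a≤b) → a≤b
      (inj₁ b<a) → case archimedes (u 0 + + 1 - v 0) of λ where
        (k , k≥) → case archimedes (v 0 + + k * (+ 2 * N) - u 0) of λ where
          (l , l≥) → case revolve l of λ where
            (n , un , vn) → ⊥-elim (absurd 0
              (below-diagonal (+ k) (linear 0 (k≥ +≤ k≤k2N k)
                  (solve 4 (λ a b c d → a ⊕ b ⊖ c := d ⊕ b ⊖ (c ⊖ a ⊕ d) ⊕ con 0)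
                    refl (v 0) (+ k * (+ 2 * N)) (u 0 + + 1) (+ k))) n +≤ ≡⇒≥ un +≤ ≡⇒≤ vn +≤ l≥ +≤ k≤k2N l +≤
               0≤* (0≤+ l) (0≤* (ℤ.i≤j⇒0≤j-i b<a) 0≤N) +≤ 0≤* (0≤+ l) (0≤* (ℤ.i≤j⇒0≤j-i b<a) 0≤N))
                (solve 9 (λ a b c d e f g h i → a ⊕ b ⊕ c ⊕ (d ⊕ e ⊗ (f ⊗ (con 2 ⊗ g))) ⊕ e ⊕ e ⊗ (con 2 ⊗ g) ⊕ e ⊗ ((h ⊖ (f ⊕ con 1)) ⊗ g) ⊕ e ⊗ ((h ⊖ (f ⊕ con 1)) ⊗ g) ⊖ (c ⊕ con 1 ⊕ (i ⊕ e ⊗ (h ⊗ (con 2 ⊗ g))) ⊕ a ⊕ (d ⊕ b ⊖ i) ⊕ e ⊕ con 0 ⊕ con 0) :=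
                    ⊝ con 1) refl (v n) (+ k * (+ 2 * N)) (u n) (v 0) (+ l) b N a (u 0)))
     where
     0≤N : + 0 ≤ N
     0≤N = 1≤⇒0≤ 1≤N
     k≤k2N : ∀ k → + k ≤ + k * (+ 2 * N)
     k≤k2N k = linear 0 (0≤* (0≤+ k) (ℤ.i≤j⇒0≤j-i (1≤2N F 1≤N)))
         (solve 2 (λ a b → a ⊗ b ⊖ a := a ⊗ (b ⊖ con 1) ⊖ con 0 ⊕ con 0) refl (+ k) (+ 2 * N))

  diagonal : ∀ {a b} → Walk F F a b → a ≡ b
  diagonal W = ℤ.≤-antisym (a≤b W) (a≤b (swap W))

-- The profile of a sign vector

infix 4 _lifts_

_lifts_ : ∀ {n} → ℤ → Fin n → Set
_lifts_ {n} z i = ∃ λ q → z ≡ + toℕ i + q * + n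

lifts-unique : ∀ {n z} {i j : Fin n} → z lifts i → z lifts j → i ≡ j
lifts-unique {n} {z} {i} {j} (q , z≡) (r , z≡′) = Fin.toℕ-injective (ℤ.+-injective (linear≡
  (sym z≡ +≡ z≡′ +≡ cong (_* + n) (ℤ.≤-antisym {r} {q} (r≤q i j z≡ z≡′) (r≤q j i z≡′ z≡)))
    (solve 5 (λ a b c d e → a ⊖ b := a ⊕ c ⊕ d ⊕ e ⊖ (d ⊕ (b ⊕ e) ⊕ c))
      refl (+ toℕ i) (+ toℕ j) (q * + n) z (r * + n))))
  where
  r≤q : ∀ (i j : Fin n) {q r} → z ≡ + toℕ i + q * + n → z ≡ + toℕ j + r * + n → r ≤ q
  r≤q i j {q} {r} z≡ z≡′ = case q <?≥ r of λ where
    (inj₂ r≤q) → r≤q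
    (inj₁ q<r) → ⊥-elim (absurd 0 (ℤ.+≤+ (Fin.toℕ<n i) +≤ 0≤+ (toℕ j) +≤ ≡⇒≤ (sym z≡′) +≤ ≡⇒≤ z≡ +≤
      0≤* (ℤ.i≤j⇒0≤j-i q<r) (0≤+ n))
        (solve 6 (λ a b c d e f → a ⊕ b ⊕ c ⊕ (d ⊕ e ⊗ a) ⊕ (f ⊖ (e ⊕ con 1)) ⊗ a ⊖ (con 1 ⊕ d ⊕ con 0 ⊕ (b ⊕ f ⊗ a) ⊕ c ⊕ con 0) :=
            ⊝ con 1) refl (+ n) (+ toℕ j) z (+ toℕ i) q r))

next-cases : ∀ {n} (i : Fin n) → toℕ (next i) ≡ suc (toℕ i) ⊎ toℕ (next i) ≡ 0 × suc (toℕ i) ≡ n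
next-cases {suc n} i = case suc (toℕ i) ℕ.<? suc n of λ where
  (yes i<n) → inj₁ (trans (Fin.toℕ-fromℕ< _) (ℕ.m<n⇒m%n≡m i<n))
  (no  i≮n) → let i≡n = ℕ.≤-antisym (Fin.toℕ<n i) (ℕ.≮⇒≥ i≮n) in
    inj₂ (trans (Fin.toℕ-fromℕ< _) (trans (cong (ℕ._% suc n) i≡n) (ℕ.n%n≡0 (suc n))) , i≡n)

lifts-next : ∀ {n z} {i : Fin n} → z lifts i → z + + 1 lifts next i
lifts-next {n} {z} {i} (q , z≡) = case next-cases i of λ where
  (inj₁ step) → q , linear≡ (z≡ +≡ cong +_ (sym step))
      (solve 4 (λ a b c d → a ⊕ con 1 ⊖ (b ⊕ c) := a ⊕ (con 1 ⊕ d) ⊖ (d ⊕ c ⊕ b))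
        refl z (+ toℕ (next i)) (q * + n) (+ toℕ i))
  (inj₂ (zero′ , last)) → q + + 1 , linear≡ (z≡ +≡ cong +_ (sym zero′) +≡ cong +_ last)
      (solve 5 (λ a b c d e → a ⊕ con 1 ⊖ (b ⊕ (c ⊕ con 1) ⊗ d) :=
          a ⊕ con 0 ⊕ (con 1 ⊕ e) ⊖ (e ⊕ c ⊗ d ⊕ b ⊕ d)) refl z (+ toℕ (next i)) q (+ n) (+ toℕ i))

lifts-prev : ∀ {n z} {i : Fin n} → z lifts next i → z - + 1 lifts i
lifts-prev {n} {z} {i} (q , z≡) = case next-cases i of λ where
  (inj₁ step) → q , linear≡ (z≡ +≡ cong +_ step)
      (solve 4 (λ a b c d → a ⊖ con 1 ⊖ (b ⊕ c) := a ⊕ d ⊖ (d ⊕ c ⊕ (con 1 ⊕ b)))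
        refl z (+ toℕ i) (q * + n) (+ toℕ (next i)))
  (inj₂ (zero′ , last)) → q - + 1 , linear≡ (z≡ +≡ cong +_ zero′ +≡ cong +_ (sym last))
      (solve 5 (λ a b c d e → a ⊖ con 1 ⊖ (b ⊕ (c ⊖ con 1) ⊗ d) :=
          a ⊕ e ⊕ d ⊖ (e ⊕ c ⊗ d ⊕ con 0 ⊕ (con 1 ⊕ b))) refl z (+ toℕ i) q (+ n) (+ toℕ (next i)))

module _ {n : ℕ} .{{_ : NonZero n}} where

  residue : ℤ → Fin n
  residue z = Fin.fromℕ< (n%ℕd<d z n)

  lifts-residue : ∀ z → z lifts residue z
  lifts-residue z = z /ℕ n , trans (a≡a%ℕn+[a/ℕn]*n z n)
    (cong (λ r → + r + (z /ℕ n) * + n) (sym (Fin.toℕ-fromℕ< (n%ℕd<d z n))))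

  residue-unique : ∀ {z i} → z lifts i → residue z ≡ i
  residue-unique {z} lifts = lifts-unique (lifts-residue z) lifts

lifts-shift : ∀ {n z} {i : Fin n} α → z lifts i → z + α * + n lifts i
lifts-shift {n} {z} {i} α (q , z≡) = q + α , linear≡ z≡
    (solve 5 (λ a b c d e → a ⊕ b ⊗ c ⊖ (d ⊕ (e ⊕ b) ⊗ c) := a ⊖ (d ⊕ e ⊗ c))
      refl z α (+ n) (+ toℕ i) q)

same-half : ∀ {z i j} → z ≡ + 2 * i ⊎ z ≡ + 2 * i + + 1 → z ≡ + 2 * j ⊎ z ≡ + 2 * j + + 1 → i ≡ j
same-half {z} {i} {j} (inj₁ e) (inj₁ e′) = ℤ.*-cancelˡ-≡ (+ 2) i j (linear≡ (e′ +≡ sym e)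
    (solve 3 (λ a b c → a ⊖ b := c ⊕ a ⊖ (b ⊕ c)) refl (+ 2 * i) (+ 2 * j) z))
same-half {z} {i} {j} (inj₁ e) (inj₂ o′) = ⊥-elim (even≢odd i j (linear≡ (o′ +≡ sym e)
    (solve 3 (λ a b c → a ⊖ b := c ⊕ a ⊖ (b ⊕ c)) refl (+ 2 * i) (+ 2 * j + + 1) z)))
same-half {z} {i} {j} (inj₂ o) (inj₁ e′) = ⊥-elim (even≢odd j i (linear≡ (o +≡ sym e′)
    (solve 3 (λ a b c → a ⊖ b := c ⊕ a ⊖ (b ⊕ c)) refl (+ 2 * j) (+ 2 * i + + 1) z)))
same-half {z} {i} {j} (inj₂ o) (inj₂ o′) = ℤ.*-cancelˡ-≡ (+ 2) i j (linear≡ (o′ +≡ sym o)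
    (solve 3 (λ a b c → a ⊖ b := c ⊕ (a ⊕ con 1) ⊖ (b ⊕ con 1 ⊕ c)) refl (+ 2 * i) (+ 2 * j) z))

half : ℤ → ℤ
half z = proj₁ (parity z)

half-even : ∀ j → half (+ 2 * j) ≡ j
half-even j = same-half (proj₂ (parity (+ 2 * j))) (inj₁ refl)

half-odd : ∀ j → half (+ 2 * j + + 1) ≡ j
half-odd j = same-half (proj₂ (parity (+ 2 * j + + 1))) (inj₂ refl)

half-shift : ∀ v n → half (v + + 2 * n) ≡ half v + n
half-shift v n = same-half (proj₂ (parity (v + + 2 * n))) (shift (proj₂ (parity v)))
  where
  shift : ∀ {h} → v ≡ + 2 * h ⊎ v ≡ + 2 * h + + 1 →
          v + + 2 * n ≡ + 2 * (h + n) ⊎ v + + 2 * n ≡ + 2 * (h + n) + + 1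
  shift {h} (inj₁ even) = inj₁ (linear≡ even
      (solve 3 (λ a b c → a ⊕ con 2 ⊗ b ⊖ con 2 ⊗ (c ⊕ b) := a ⊖ con 2 ⊗ c) refl v n h))
  shift {h} (inj₂ odd)  = inj₂ (linear≡ odd
      (solve 3 (λ a b c → a ⊕ con 2 ⊗ b ⊖ (con 2 ⊗ (c ⊕ b) ⊕ con 1) := a ⊖ (con 2 ⊗ c ⊕ con 1))
        refl v n h))

-- Finite sums and discrete integrals

∑ : (ℕ → ℤ) → ℕ → ℤ
∑ f zero    = + 0
∑ f (suc n) = f 0 + ∑ (f ∘ suc) n

∑-last : ∀ f n → ∑ f (suc n) ≡ ∑ f n + f n
∑-last f zero    = ℤ.+-comm (f 0) (+ 0)
∑-last f (suc n) = trans (cong (λ s → f 0 + s) (∑-last (f ∘ suc) n))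
  (sym (ℤ.+-assoc (f 0) (∑ (f ∘ suc) n) (f (suc n))))

count-∷ : ∀ {A : Set} {P : A → Set} (P? : ∀ a → Dec (P a)) a {n} (as : Vec A n) →
          count P? (a ∷ as) ≡ count P? (a ∷ []) ℕ.+ count P? as
count-∷ P? a as with P? a
... | yes _ = refl
... | no  _ = refl

-- The weight of an entry is given by counts over a one-element vector, so that the same statement
-- serves `k`, `Δx` and `Δy`.
∑-count : ∀ {A : Set} {P Q : A → Set} (P? : ∀ a → Dec (P a)) (Q? : ∀ a → Dec (Q a)) (w : A → ℤ) →
          (∀ a → w a ≡ + count P? (a ∷ []) - + count Q? (a ∷ [])) →
          ∀ {n} (as : Vec A n) f → (∀ i → f (toℕ i) ≡ w (lookup as i)) →
          ∑ f n ≡ + count P? as - + count Q? as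
∑-count P? Q? w w≡ []       f f≡ = refl
∑-count P? Q? w w≡ (a ∷ as) f f≡ = trans
  (cong₂ _+_ (trans (f≡ Fin.zero) (w≡ a)) (∑-count P? Q? w w≡ as (f ∘ suc) (f≡ ∘ Fin.suc)))
  (regroup (count P? (a ∷ [])) (count P? as) (count Q? (a ∷ [])) (count Q? as)
    (count-∷ P? a as) (count-∷ Q? a as))
  where
  regroup : ∀ p p′ q q′ {p″ q″} → p″ ≡ p ℕ.+ p′ → q″ ≡ q ℕ.+ q′ →
            (+ p - + q) + (+ p′ - + q′) ≡ + p″ - + q″
  regroup p p′ q q′ refl refl =
      (solve 4 (λ a b c d → a ⊖ b ⊕ (c ⊖ d) := a ⊕ c ⊖ (b ⊕ d)) refl (+ p) (+ q) (+ p′) (+ q′))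

∫ : (ℤ → ℤ) → ℤ → ℤ
∫ σ (+ zero)     = + 0
∫ σ (+ suc n)    = ∫ σ (+ n) + σ (+ n)
∫ σ -[1+ zero ]  = - σ -[1+ 0 ]
∫ σ -[1+ suc n ] = ∫ σ -[1+ n ] - σ -[1+ suc n ]

∫-step : ∀ σ v → ∫ σ (v + + 1) ≡ ∫ σ v + σ v
∫-step σ (+ n)        = cong (∫ σ ∘ +_) (ℕ.+-comm n 1)
∫-step σ -[1+ zero ]  = sym (ℤ.+-inverseˡ (σ -[1+ 0 ]))
∫-step σ -[1+ suc n ] = add-back (∫ σ -[1+ n ]) (σ -[1+ suc n ])
  where
  add-back : ∀ i j → i ≡ i - j + j
  add-back i j = solve 2 (λ a b → a := a ⊖ b ⊕ b) refl i j

shift-invariant : ∀ (f : ℤ → ℤ) → (∀ v → f (v + + 1) ≡ f v) → ∀ v → f v ≡ f (+ 0)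
shift-invariant f inv (+ zero)     = refl
shift-invariant f inv (+ suc n)    =
  trans (cong (f ∘ +_) (ℕ.+-comm 1 n)) (trans (inv (+ n)) (shift-invariant f inv (+ n)))
shift-invariant f inv -[1+ zero ]  = sym (inv -[1+ 0 ])
shift-invariant f inv -[1+ suc n ] = trans (sym (inv -[1+ suc n ])) (shift-invariant f inv -[1+ n ])

sgn : Sign → ℤ
sgn Sign.+ = + 1
sgn Sign.- = -[1+ 0 ]

module _ {N : ℕ} .{{_ : NonZero N}} (x : Vec Sign N) where

  slope : ℤ → ℤ
  slope z = sgn (lookup x (residue z))

  slope-lifts : ∀ {z i} → z lifts i → slope z ≡ sgn (lookup x i)
  slope-lifts lifts = cong (sgn ∘ lookup x) (residue-unique lifts)

  slope-periodic : ∀ z → slope (z + + N) ≡ slope z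
  slope-periodic z = slope-lifts
    (subst (_lifts residue z) (cong (λ p → z + p) (ℤ.*-identityˡ (+ N))) (lifts-shift (+ 1) (lifts-residue z)))

  ∑-slope : ∑ (slope ∘ +_) N ≡ k x
  ∑-slope = ∑-count (Sign._≟ Sign.+) (Sign._≟ Sign.-) sgn
    (λ { Sign.+ → refl ; Sign.- → refl }) x (slope ∘ +_) (λ i → slope-lifts {+ toℕ i} (+ 0 , sym (ℤ.+-identityʳ _)))

  -- Composing with `half` gives the sign of lattice line `j` to both steps from `2j` to `2j + 2`.
  height : ℤ → ℤ
  height = ∫ (slope ∘ half)

  height-from-even : ∀ j → height (+ 2 * j + + 1) ≡ height (+ 2 * j) + slope j
  height-from-even j = trans (∫-step (slope ∘ half) (+ 2 * j))
    (cong (λ z → height (+ 2 * j) + slope z) (half-even j))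

  height-from-odd : ∀ j → height (+ 2 * j + + 2) ≡ height (+ 2 * j + + 1) + slope j
  height-from-odd j = trans (cong height {+ 2 * j + + 2} {+ 2 * j + + 1 + + 1}
      (solve 1 (λ a → a ⊕ con 2 := a ⊕ con 1 ⊕ con 1) refl (+ 2 * j)))
    (trans (∫-step (slope ∘ half) (+ 2 * j + + 1))
      (cong (λ z → height (+ 2 * j + + 1) + slope z) (half-odd j)))

  height-double : ∀ n → height (+ 2 * + n) ≡ + 2 * ∑ (slope ∘ +_) n
  height-double zero    = refl
  height-double (suc n) = linear≡
    (cong height {+ 2 * + suc n} {+ 2 * + n + + 2}
        (solve 1 (λ a → con 2 ⊗ (con 1 ⊕ a) := con 2 ⊗ a ⊕ con 2)
          refl (+ n)) +≡ height-from-odd (+ n) +≡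
     height-from-even (+ n) +≡ height-double n +≡ sym last +≡ sym last)
      (solve 7 (λ a b c d e f g → a ⊖ con 2 ⊗ b :=
          a ⊕ c ⊕ d ⊕ e ⊕ (f ⊕ g) ⊕ (f ⊕ g) ⊖ (c ⊕ (d ⊕ g) ⊕ (e ⊕ g) ⊕ con 2 ⊗ f ⊕ b ⊕ b))
        refl (height (+ 2 * + suc n)) (∑ (slope ∘ +_) (suc n)) (height (+ 2 * + n + + 2)) (height (+ 2 * + n + + 1)) (height (+ 2 * + n)) (∑ (slope ∘ +_) n) (slope (+ n)))
    where
    last : ∑ (slope ∘ +_) (suc n) ≡ ∑ (slope ∘ +_) n + slope (+ n)
    last = ∑-last (slope ∘ +_) n

  profile : Profile (+ N) (+ 2 * k x)
  profile = record
    { ht    = height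
    ; unit  = λ v → case-sign v (lookup x (residue (half v))) refl
    ; line  = λ j → linear≡ (height-from-odd j +≡ sym (height-from-even j))
        (solve 4 (λ a b c d → a ⊕ b ⊖ con 2 ⊗ c := a ⊕ (b ⊕ d) ⊖ (c ⊕ d ⊕ c))
          refl (height (+ 2 * j + + 2)) (height (+ 2 * j)) (height (+ 2 * j + + 1)) (slope j))
    -- The slopes are periodic, so the gain over one period does not depend on the starting point.
    -- It is computed at 0, where it is twice the sum of the signs.
    ; quasi = λ v → linear≡ (gain-constant v +≡ height-double N +≡
        cong height {+ 0 + + 2 * + N} {+ 2 * + N} (solve 1 (λ a → con 0 ⊕ con 2 ⊗ a := con 2 ⊗ a)
                                                    refl (+ N)) +≡ ∑-slope +≡ ∑-slope)
        (solve 6 (λ a b c d e f → a ⊖ (b ⊕ con 2 ⊗ c) :=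
            a ⊖ b ⊕ d ⊕ e ⊕ f ⊕ f ⊖ (e ⊖ con 0 ⊕ con 2 ⊗ f ⊕ d ⊕ c ⊕ c))
          refl (height (v + + 2 * + N)) (height v) (k x) (height (+ 2 * + N)) (height (+ 0 + + 2 * + N)) (∑ (slope ∘ +_) N))
    }
    where
    case-sign : ∀ v s → lookup x (residue (half v)) ≡ s →
                height (v + + 1) ≡ height v + + 1 ⊎ height (v + + 1) ≡ height v - + 1
    case-sign v Sign.+ eq = inj₁ (trans (∫-step (slope ∘ half) v) (cong (λ s → height v + sgn s) eq))
    case-sign v Sign.- eq = inj₂ (trans (∫-step (slope ∘ half) v) (cong (λ s → height v + sgn s) eq))

    gain : ℤ → ℤ
    gain v = height (v + + 2 * + N) - height v

    gain-invariant : ∀ v → gain (v + + 1) ≡ gain v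
    gain-invariant v = linear≡
      {x = height (v + + 1 + + 2 * + N) - height (v + + 1)} {height (v + + 2 * + N) - height v}
      (cong height {v + + 1 + + 2 * + N} {v + + 2 * + N + + 1}
          (solve 2 (λ a b → a ⊕ con 1 ⊕ b := a ⊕ b ⊕ con 1) refl v (+ 2 * + N)) +≡
       climb (v + + 2 * + N) +≡ sym (climb v) +≡ periodic)
        (solve 7 (λ a b c d e f g → a ⊖ b ⊖ (c ⊖ d) := a ⊕ e ⊕ (d ⊕ f) ⊕ g ⊖ (e ⊕ (c ⊕ g) ⊕ b ⊕ f))
          refl (height (v + + 1 + + 2 * + N)) (height (v + + 1)) (height (v + + 2 * + N)) (height v) (height (v + + 2 * + N + + 1)) (slope (half v)) (slope (half (v + + 2 * + N))))
      where
      climb : ∀ w → height (w + + 1) ≡ height w + slope (half w)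
      climb = ∫-step (slope ∘ half)
      periodic : slope (half (v + + 2 * + N)) ≡ slope (half v)
      periodic = trans (cong slope (half-shift v (+ N))) (slope-periodic (half v))

    gain-constant : ∀ v → height (v + + 2 * + N) - height v ≡ height (+ 0 + + 2 * + N) - + 0
    gain-constant = shift-invariant gain gain-invariant

-- Turning from one edge into the next

advance : ∀ z s → + 2 * (z + s) + + 1 ≡ + 2 * z + + 1 + s + s
advance z s = solve 2 (λ a b → con 2 ⊗ (a ⊕ b) ⊕ con 1 := con 2 ⊗ a ⊕ con 1 ⊕ b ⊕ b) refl z s

module _ {N : ℕ} .{{_ : NonZero N}} (x : Vec Sign N) where

  -- The `leave` lemmas go from the centre of line `j` to its boundary, with the slope of `j`; the
  -- `arrive` lemmas go from that boundary to the centre of the neighbouring line, with the slope of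
  -- the neighbour.
  leave-up : ∀ j → height x (+ 2 * j + + 1 + + 1) ≡ height x (+ 2 * j + + 1) + slope x j
  leave-up j = trans (cong (height x) {+ 2 * j + + 1 + + 1} {+ 2 * j + + 2}
      (solve 1 (λ a → a ⊕ con 1 ⊕ con 1 := a ⊕ con 2) refl (+ 2 * j))) (height-from-odd x j)

  leave-down : ∀ j → height x (+ 2 * j + + 1 + -[1+ 0 ]) ≡ height x (+ 2 * j + + 1) - slope x j
  leave-down j = linear≡
    (cong (height x) {+ 2 * j + + 1 + -[1+ 0 ]} {+ 2 * j}
        (solve 1 (λ a → con 2 ⊗ a ⊕ con 1 ⊕ ⊝ con 1 := con 2 ⊗ a)
          refl j) +≡ sym (height-from-even x j))
      (solve 4 (λ a b c d → a ⊖ (b ⊖ c) := a ⊕ (d ⊕ c) ⊖ (d ⊕ b))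
        refl (height x (+ 2 * j + + 1 + -[1+ 0 ])) (height x (+ 2 * j + + 1)) (slope x j) (height x (+ 2 * j)))

  arrive-up : ∀ j → height x (+ 2 * (j + + 1) + + 1) ≡ height x (+ 2 * j + + 1 + + 1) + slope x (j + + 1)
  arrive-up j = linear≡ (height-from-even x (j + + 1) +≡
    cong (height x) {+ 2 * (j + + 1)} {+ 2 * j + + 1 + + 1}
        (solve 1 (λ a → con 2 ⊗ (a ⊕ con 1) := con 2 ⊗ a ⊕ con 1 ⊕ con 1) refl j))
      (solve 4 (λ a b c d → a ⊖ (b ⊕ c) := a ⊕ d ⊖ (d ⊕ c ⊕ b))
        refl (height x (+ 2 * (j + + 1) + + 1)) (height x (+ 2 * j + + 1 + + 1)) (slope x (j + + 1)) (height x (+ 2 * (j + + 1))))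

  arrive-down : ∀ j → height x (+ 2 * (j + -[1+ 0 ]) + + 1) ≡
                      height x (+ 2 * j + + 1 + -[1+ 0 ]) - slope x (j + -[1+ 0 ])
  arrive-down j = linear≡ (sym (height-from-odd x (j + -[1+ 0 ])) +≡
    cong (height x) {+ 2 * (j + -[1+ 0 ]) + + 2} {+ 2 * j + + 1 + -[1+ 0 ]}
        (solve 1 (λ a → con 2 ⊗ (a ⊕ ⊝ con 1) ⊕ con 2 := con 2 ⊗ a ⊕ con 1 ⊕ ⊝ con 1) refl j))
      (solve 4 (λ a b c d → a ⊖ (b ⊖ c) := a ⊕ c ⊕ d ⊖ (d ⊕ b))
        refl (height x (+ 2 * (j + -[1+ 0 ]) + + 1)) (height x (+ 2 * j + + 1 + -[1+ 0 ])) (slope x (j + -[1+ 0 ])) (height x (+ 2 * (j + -[1+ 0 ]) + + 2)))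

-- The loop turns from a horizontal edge of direction `s` into a vertical edge of direction `t`.
-- Between their midpoints `v` moves by `t` in a row of slope `s`, and `u` moves by `s` in a column
-- of slope `t`. Both heights change by the product of `s` and `t`, whence the conserved level.
turn : ∀ {N M} .{{_ : NonZero N}} .{{_ : NonZero M}} (x : Vec Sign N) (y : Vec Sign M) z w s t →
       slope x w ≡ sgn s → slope y (z + sgn s) ≡ sgn t → ∀ {u v u′ v′} →
       u ≡ + 2 * z + + 1 + sgn s → v ≡ + 2 * w + + 1 →
       u′ ≡ + 2 * (z + sgn s) + + 1 → v′ ≡ + 2 * w + + 1 + sgn t →
       Move u v (height x v) (height y u) u′ v′ (height x v′) (height y u′)
turn x y z w Sign.+ Sign.+ xw yz refl refl refl refl = NE (advance z (+ 1)) refl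
  (trans (leave-up x w) (cong (λ s → height x (+ 2 * w + + 1) + s) xw))
  (trans (arrive-up y z) (cong (λ t → height y (+ 2 * z + + 1 + + 1) + t) yz))
turn x y z w Sign.+ Sign.- xw yz refl refl refl refl = SE (advance z (+ 1)) refl
  (trans (leave-down x w) (cong (λ s → height x (+ 2 * w + + 1) - s) xw))
  (trans (arrive-up y z) (cong (λ t → height y (+ 2 * z + + 1 + + 1) + t) yz))
turn x y z w Sign.- Sign.+ xw yz refl refl refl refl = NW (advance z -[1+ 0 ]) refl
  (trans (leave-up x w) (cong (λ s → height x (+ 2 * w + + 1) + s) xw))
  (trans (arrive-down y z) (cong (λ t → height y (+ 2 * z + + 1 + -[1+ 0 ]) - t) yz))
turn x y z w Sign.- Sign.- xw yz refl refl refl refl = SW (advance z -[1+ 0 ]) refl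
  (trans (leave-down x w) (cong (λ s → height x (+ 2 * w + + 1) - s) xw))
  (trans (arrive-down y z) (cong (λ t → height y (+ 2 * z + + 1 + -[1+ 0 ]) - t) yz))

halve : ∀ c z z′ α P {u u′} → u ≡ + 2 * z + c → u′ ≡ + 2 * z′ + c → u ≡ u′ + α * (+ 2 * P) → z ≡ z′ + α * P
halve c z z′ α P refl refl eq = ℤ.*-cancelˡ-≡ (+ 2) z (z′ + α * P) (linear≡ eq
  (solve 5 (λ c z z′ α P → con 2 ⊗ z ⊖ con 2 ⊗ (z′ ⊕ α ⊗ P) :=
                           con 2 ⊗ z ⊕ c ⊖ (con 2 ⊗ z′ ⊕ c ⊕ α ⊗ (con 2 ⊗ P))) refl c z z′ α P))

not-halves : ∀ z z′ α P {u u′} → u ≡ + 2 * z + + 1 → u′ ≡ + 2 * z′ + + 2 → u ≢ u′ + α * (+ 2 * P)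
not-halves z z′ α P refl refl eq = even≢odd (z′ + + 1 + α * P) z (linear≡ (sym eq)
  (solve 4 (λ z z′ α P → con 2 ⊗ (z′ ⊕ con 1 ⊕ α ⊗ P) ⊖ (con 2 ⊗ z ⊕ con 1) :=
                         con 2 ⊗ z′ ⊕ con 2 ⊕ α ⊗ (con 2 ⊗ P) ⊖ (con 2 ⊗ z ⊕ con 1)) refl z z′ α P))

-- Lifting edges to the refined grid

module _ {M N : ℕ} .{{_ : NonZero M}} .{{_ : NonZero N}} (x : Vec Sign N) (y : Vec Sign M) where
  open Pattern x y using (source; target)

  -- The two coordinates of the displacement along an oriented edge.
  ξ η : Edge M N → ℤ
  ξ (horizontal , _ , j) = sgn (lookup x j)
  ξ (vertical   , _ , _) = + 0
  η (horizontal , _ , _) = + 0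
  η (vertical   , i , _) = sgn (lookup y i)

  infix 4 _over_

  _over_ : ℤ × ℤ → Vertex M N → Set
  (z , w) over (i , j) = z lifts i × w lifts j

  target-over : ∀ e {z w} → (z , w) over source e → (z + ξ e , w + η e) over target e
  target-over (horizontal , i , j) {z} {w} (zi , wj) with lookup x j
  ... | Sign.+ = lifts-next zi , subst (_lifts j) (sym (ℤ.+-identityʳ w)) wj
  ... | Sign.- = lifts-prev zi , subst (_lifts j) (sym (ℤ.+-identityʳ w)) wj
  target-over (vertical , i , j) {z} {w} (zi , wj) with lookup y i
  ... | Sign.+ = subst (_lifts i) (sym (ℤ.+-identityʳ z)) zi , lifts-next wj
  ... | Sign.- = subst (_lifts i) (sym (ℤ.+-identityʳ z)) zi , lifts-prev wj

  -- The point (2i, 2j) of the refined grid is the corner between columns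
  -- i - 1, i and rows j - 1, j, so the vertex (i, j) sits at (2i + 1, 2j + 1).
  Midpoint : Edge M N → ℤ → ℤ → Set
  Midpoint (horizontal , i , j) u v = ∃₂ λ z w → (z , w) over (i , j) × u ≡ + 2 * z + + 2 × v ≡ + 2 * w + + 1
  Midpoint (vertical   , i , j) u v = ∃₂ λ z w → (z , w) over (i , j) × u ≡ + 2 * z + + 1 × v ≡ + 2 * w + + 2

  midpoint : ∀ e {z w} → (z , w) over source e → Midpoint e (+ 2 * z + + 1 + ξ e) (+ 2 * w + + 1 + η e)
  midpoint (horizontal , i , j) {z} {w} (zi , wj) with lookup x j
  ... | Sign.+ = z , w , (zi , wj) , ℤ.+-assoc (+ 2 * z) (+ 1) (+ 1) , ℤ.+-identityʳ _
  ... | Sign.- = z - + 1 , w , (lifts-prev zi , wj) , back z , ℤ.+-identityʳ _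
    where
    back : ∀ z → + 2 * z + + 1 + -[1+ 0 ] ≡ + 2 * (z - + 1) + + 2
    back z = solve 1 (λ a → con 2 ⊗ a ⊕ con 1 ⊕ ⊝ con 1 := con 2 ⊗ (a ⊖ con 1) ⊕ con 2) refl z
  midpoint (vertical , i , j) {z} {w} (zi , wj) with lookup y i
  ... | Sign.+ = z , w , (zi , wj) , ℤ.+-identityʳ _ , ℤ.+-assoc (+ 2 * w) (+ 1) (+ 1)
  ... | Sign.- = z , w - + 1 , (zi , lifts-prev wj) , ℤ.+-identityʳ _ , back w
    where
    back : ∀ w → + 2 * w + + 1 + -[1+ 0 ] ≡ + 2 * (w - + 1) + + 2
    back w = solve 1 (λ a → con 2 ⊗ a ⊕ con 1 ⊕ ⊝ con 1 := con 2 ⊗ (a ⊖ con 1) ⊕ con 2) refl w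

  midpoint-odd : ∀ e {u v} → Midpoint e u v → ∃ λ w → u + v ≡ + 2 * w + + 1
  midpoint-odd (horizontal , _) (z , w , _ , refl , refl) = z + w + + 1 ,
      (solve 2 (λ a b → con 2 ⊗ a ⊕ con 2 ⊕ (con 2 ⊗ b ⊕ con 1) := con 2 ⊗ (a ⊕ b ⊕ con 1) ⊕ con 1)
        refl z w)
  midpoint-odd (vertical   , _) (z , w , _ , refl , refl) = z + w + + 1 ,
      (solve 2 (λ a b → con 2 ⊗ a ⊕ con 1 ⊕ (con 2 ⊗ b ⊕ con 2) := con 2 ⊗ (a ⊕ b ⊕ con 1) ⊕ con 1)
        refl z w)

  -- The parities of a midpoint's coordinates reveal the axis of its edge. Halving them then gives
  -- the lower endpoint up to periods.
  same-edge : ∀ e e′ {u v u′ v′} α β → Midpoint e u v → Midpoint e′ u′ v′ →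
              u ≡ u′ + α * (+ 2 * + M) → v ≡ v′ + β * (+ 2 * + N) → e ≡ e′
  same-edge (horizontal , _) (horizontal , _) α β (z , w , (zi , wj) , u≡ , v≡) (z′ , w′ , (zi′ , wj′) , u≡′ , v≡′) u v =
    cong₂ (λ i j → horizontal , i , j)
      (lifts-unique zi (subst (_lifts _) (sym (halve (+ 2) z z′ α (+ M) u≡ u≡′ u)) (lifts-shift α zi′)))
      (lifts-unique wj (subst (_lifts _) (sym (halve (+ 1) w w′ β (+ N) v≡ v≡′ v)) (lifts-shift β wj′)))
  same-edge (vertical , _) (vertical , _) α β (z , w , (zi , wj) , u≡ , v≡) (z′ , w′ , (zi′ , wj′) , u≡′ , v≡′) u v =
    cong₂ (λ i j → vertical , i , j)
      (lifts-unique zi (subst (_lifts _) (sym (halve (+ 1) z z′ α (+ M) u≡ u≡′ u)) (lifts-shift α zi′)))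
      (lifts-unique wj (subst (_lifts _) (sym (halve (+ 2) w w′ β (+ N) v≡ v≡′ v)) (lifts-shift β wj′)))
  same-edge (horizontal , _) (vertical , _) α β (z , w , _ , _ , v≡) (z′ , w′ , _ , _ , v≡′) u v =
    ⊥-elim (not-halves w w′ β (+ N) v≡ v≡′ v)
  same-edge (vertical , _) (horizontal , _) α β (z , w , _ , u≡ , _) (z′ , w′ , _ , u≡′ , _) u v =
    ⊥-elim (not-halves z z′ α (+ M) u≡ u≡′ u)

  source-row : ∀ i j → proj₂ (source (horizontal , i , j)) ≡ j
  source-row i j with lookup x j
  ... | Sign.+ = refl
  ... | Sign.- = refl

  source-column : ∀ i j → proj₁ (source (vertical , i , j)) ≡ i
  source-column i j with lookup y i
  ... | Sign.+ = refl
  ... | Sign.- = refl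

  move-along : ∀ e e′ z w → (z , w) over source e → (z + ξ e , w + η e) over source e′ → axis e ≢ axis e′ →
    ∀ {u v u′ v′} → u ≡ + 2 * z + + 1 + ξ e → v ≡ + 2 * w + + 1 + η e →
    u′ ≡ + 2 * (z + ξ e) + + 1 + ξ e′ → v′ ≡ + 2 * (w + η e) + + 1 + η e′ →
    Move u v (height x v) (height y u) u′ v′ (height x v′) (height y u′)
  move-along (horizontal , i , j) (vertical , i′ , j′) z w (_ , wj) (zi′ , _) _ u v u′ v′ =
    turn x y z w (lookup x j) (lookup y i′)
      (slope-lifts x (subst (w lifts_) (source-row i j) wj))
      (slope-lifts y (subst (z + sgn (lookup x j) lifts_) (source-column i′ j′) zi′))
      u (trans v (ℤ.+-identityʳ _)) (trans u′ (ℤ.+-identityʳ _))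
      (trans v′ (cong (λ w → + 2 * w + + 1 + η (vertical , i′ , j′)) (ℤ.+-identityʳ w)))
  -- The same turn with the two axes, and hence the two strings, exchanged.
  move-along (vertical , i , j) (horizontal , i′ , j′) z w (zi , _) (_ , wj′) _ u v u′ v′ =
    flip (turn y x w z (lookup y i) (lookup x j′)
      (slope-lifts y (subst (z lifts_) (source-column i j) zi))
      (slope-lifts x (subst (w + sgn (lookup y i) lifts_) (source-row i′ j′) wj′))
      v (trans u (ℤ.+-identityʳ _)) (trans v′ (ℤ.+-identityʳ _))
      (trans u′ (cong (λ z → + 2 * z + + 1 + ξ (horizontal , i′ , j′)) (ℤ.+-identityʳ z))))
  move-along (horizontal , _) (horizontal , _) _ _ _ _ turns = ⊥-elim (turns refl)
  move-along (vertical   , _) (vertical   , _) _ _ _ _ turns = ⊥-elim (turns refl)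

-- The walk of a loop

mod-cong : ∀ {m n d} .{{_ : NonZero d}} → m ℕ.% d ≡ n ℕ.% d → m mod d ≡ n mod d
mod-cong {m} {n} {d} eq = Fin.toℕ-injective
  (trans (Fin.toℕ-fromℕ< (ℕ.m%n<n m d)) (trans eq (sym (Fin.toℕ-fromℕ< (ℕ.m%n<n n d)))))

mod-injective : ∀ {m n d} .{{_ : NonZero d}} → m mod d ≡ n mod d → m ℕ.% d ≡ n ℕ.% d
mod-injective {m} {n} {d} eq =
  trans (sym (Fin.toℕ-fromℕ< (ℕ.m%n<n m d))) (trans (cong toℕ eq) (Fin.toℕ-fromℕ< (ℕ.m%n<n n d)))

toℕ-mod : ∀ {d} (i : Fin (suc d)) → toℕ i mod suc d ≡ i
toℕ-mod {d} i = Fin.toℕ-injective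
  (trans (Fin.toℕ-fromℕ< (ℕ.m%n<n (toℕ i) (suc d))) (ℕ.m<n⇒m%n≡m (Fin.toℕ<n i)))

next-mod : ∀ n d → next (n mod suc d) ≡ suc n mod suc d
next-mod n d = mod-cong {suc (toℕ (n mod suc d))} {suc n} (begin
  suc (toℕ (n mod suc d)) ℕ.% suc d                  ≡⟨ cong (λ r → suc r ℕ.% suc d) (Fin.toℕ-fromℕ< (ℕ.m%n<n n (suc d))) ⟩
  suc (n ℕ.% suc d) ℕ.% suc d                        ≡⟨ ℕ.%-distribˡ-+ 1 (n ℕ.% suc d) (suc d) ⟩
  (1 ℕ.% suc d ℕ.+ n ℕ.% suc d ℕ.% suc d) ℕ.% suc d  ≡⟨ cong (λ r → (1 ℕ.% suc d ℕ.+ r) ℕ.% suc d) (ℕ.m%n%n≡m%n n (suc d)) ⟩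
  (1 ℕ.% suc d ℕ.+ n ℕ.% suc d) ℕ.% suc d            ≡⟨ ℕ.%-distribˡ-+ 1 n (suc d) ⟨
  suc n ℕ.% suc d                                    ∎)
  where open ≡-Reasoning

∑-period : ∀ f p → (∀ n → f (n ℕ.+ p) ≡ f n) → ∀ n → ∑ f (n ℕ.+ p) ≡ ∑ f n + ∑ f p
∑-period f p periodic zero    = sym (ℤ.+-identityˡ (∑ f p))
∑-period f p periodic (suc n) = linear≡ {x = ∑ f (suc (n ℕ.+ p))} {∑ f (suc n) + ∑ f p}
  (∑-last f (n ℕ.+ p) +≡ ∑-period f p periodic n +≡ periodic n +≡ sym (∑-last f n))
    (solve 7 (λ a b c d e f g → a ⊖ (b ⊕ c) := a ⊕ d ⊕ e ⊕ (f ⊕ g) ⊖ (d ⊕ e ⊕ (f ⊕ c) ⊕ g ⊕ b))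
      refl (∑ f (suc (n ℕ.+ p))) (∑ f (suc n)) (∑ f p) (∑ f (n ℕ.+ p)) (f (n ℕ.+ p)) (∑ f n) (f n))

iterate-period : ∀ (f : ℕ → ℤ) p c → (∀ n → f (n ℕ.+ p) ≡ f n + c) → ∀ q n → f (n ℕ.+ q ℕ.* p) ≡ f n + + q * c
iterate-period f p c step zero    n = linear≡ {x = f (n ℕ.+ 0)} {f n + + 0 * c} (cong f (ℕ.+-identityʳ n))
    (solve 3 (λ a b c → a ⊖ (b ⊕ con 0 ⊗ c) := a ⊖ b) refl (f (n ℕ.+ 0)) (f n) c)
iterate-period f p c step (suc q) n = linear≡ {x = f (n ℕ.+ (p ℕ.+ q ℕ.* p))} {f n + + suc q * c}
  (cong f (sym (ℕ.+-assoc n p (q ℕ.* p))) +≡ iterate-period f p c step q (n ℕ.+ p) +≡ step n)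
    (solve 6 (λ a b c d e f → a ⊖ (b ⊕ (con 1 ⊕ c) ⊗ d) := a ⊕ e ⊕ f ⊖ (e ⊕ (f ⊕ c ⊗ d) ⊕ (b ⊕ d)))
      refl (f (n ℕ.+ (p ℕ.+ q ℕ.* p))) (f n) (+ q) c (f (n ℕ.+ p ℕ.+ q ℕ.* p)) (f (n ℕ.+ p)))

module _ {M N : ℕ} .{{_ : NonZero M}} .{{_ : NonZero N}} (x : Vec Sign N) (y : Vec Sign M) (L : Loop x y) where
  open Pattern x y using (source; target; heading; Δx; Δy)
  open Pattern.Loop L

  len : ℕ
  len = suc length-1

  -- The loop unrolled into an infinite periodic sequence of edges.
  e : ℕ → Edge M N
  e n = lookup edges (n mod len)

  e-connected : ∀ n → target (e n) ≡ source (e (suc n))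
  e-connected n = trans (connected (n mod len)) (cong (source ∘ lookup edges) (next-mod n length-1))

  e-alternating : ∀ n → axis (e n) ≢ axis (e (suc n))
  e-alternating n = subst (λ i → axis (e n) ≢ axis (lookup edges i)) (next-mod n length-1) (alternating (n mod len))

  e-period : ∀ n → e (n ℕ.+ len) ≡ e n
  e-period n = cong (lookup edges) (mod-cong {n ℕ.+ len} {n} (ℕ.[m+n]%n≡m%n n len))

  e-injective : ∀ m n → e m ≡ e n → m ℕ.% len ≡ n ℕ.% len
  e-injective m n eq = mod-injective {m} {n} (lookup-injective trail _ _ eq)

  ∑ξ : ∑ (ξ x y ∘ e) len ≡ Δx L
  ∑ξ = ∑-count (λ e → ≡-dec _≟ᴬ_ Sign._≟_ (heading e) (horizontal , Sign.+))
               (λ e → ≡-dec _≟ᴬ_ Sign._≟_ (heading e) (horizontal , Sign.-)) (ξ x y) signed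
               edges (ξ x y ∘ e) (λ i → cong (ξ x y ∘ lookup edges) (toℕ-mod i))
    where
    signed : ∀ a → ξ x y a ≡ + count (λ e → ≡-dec _≟ᴬ_ Sign._≟_ (heading e) (horizontal , Sign.+)) (a ∷ [])
                           - + count (λ e → ≡-dec _≟ᴬ_ Sign._≟_ (heading e) (horizontal , Sign.-)) (a ∷ [])
    signed (horizontal , i , j) with lookup x j
    ... | Sign.+ = refl
    ... | Sign.- = refl
    signed (vertical , i , j) = refl

  ∑η : ∑ (η x y ∘ e) len ≡ Δy L
  ∑η = ∑-count (λ e → ≡-dec _≟ᴬ_ Sign._≟_ (heading e) (vertical , Sign.+))
               (λ e → ≡-dec _≟ᴬ_ Sign._≟_ (heading e) (vertical , Sign.-)) (η x y) signed
               edges (η x y ∘ e) (λ i → cong (η x y ∘ lookup edges) (toℕ-mod i))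
    where
    signed : ∀ a → η x y a ≡ + count (λ e → ≡-dec _≟ᴬ_ Sign._≟_ (heading e) (vertical , Sign.+)) (a ∷ [])
                           - + count (λ e → ≡-dec _≟ᴬ_ Sign._≟_ (heading e) (vertical , Sign.-)) (a ∷ [])
    signed (horizontal , i , j) = refl
    signed (vertical , i , j) with lookup y i
    ... | Sign.+ = refl
    ... | Sign.- = refl

  -- The source of `e n` lifted to ℤ × ℤ, by summing displacements from a fixed lift of the first
  -- source.
  z w : ℕ → ℤ
  z n = + toℕ (proj₁ (source (e 0))) + ∑ (ξ x y ∘ e) n
  w n = + toℕ (proj₂ (source (e 0))) + ∑ (η x y ∘ e) n

  z-step : ∀ n → z (suc n) ≡ z n + ξ x y (e n)
  z-step n = trans (cong (λ s → + toℕ (proj₁ (source (e 0))) + s) (∑-last (ξ x y ∘ e) n))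
    (sym (ℤ.+-assoc (+ toℕ (proj₁ (source (e 0)))) (∑ (ξ x y ∘ e) n) (ξ x y (e n))))

  w-step : ∀ n → w (suc n) ≡ w n + η x y (e n)
  w-step n = trans (cong (λ s → + toℕ (proj₂ (source (e 0))) + s) (∑-last (η x y ∘ e) n))
    (sym (ℤ.+-assoc (+ toℕ (proj₂ (source (e 0)))) (∑ (η x y ∘ e) n) (η x y (e n))))

  z-period : ∀ n → z (n ℕ.+ len) ≡ z n + Δx L
  z-period n = trans
    (cong (λ s → + toℕ (proj₁ (source (e 0))) + s)
      (trans (∑-period (ξ x y ∘ e) len (cong (ξ x y) ∘ e-period) n) (cong (λ s → ∑ (ξ x y ∘ e) n + s) ∑ξ)))
    (sym (ℤ.+-assoc (+ toℕ (proj₁ (source (e 0)))) (∑ (ξ x y ∘ e) n) (Δx L)))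

  w-period : ∀ n → w (n ℕ.+ len) ≡ w n + Δy L
  w-period n = trans
    (cong (λ s → + toℕ (proj₂ (source (e 0))) + s)
      (trans (∑-period (η x y ∘ e) len (cong (η x y) ∘ e-period) n) (cong (λ s → ∑ (η x y ∘ e) n + s) ∑η)))
    (sym (ℤ.+-assoc (+ toℕ (proj₂ (source (e 0)))) (∑ (η x y ∘ e) n) (Δy L)))

  z,w-next : ∀ n {v} → _over_ x y (z n + ξ x y (e n) , w n + η x y (e n)) v → _over_ x y (z (suc n) , w (suc n)) v
  z,w-next n {v} over = subst₂ (λ z w → _over_ x y (z , w) v) (sym (z-step n)) (sym (w-step n)) over

  z,w-over : ∀ n → _over_ x y (z n , w n) (source (e n))
  z,w-over zero    = (+ 0 , refl) , (+ 0 , refl)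
  z,w-over (suc n) = z,w-next n
    (subst (_over_ x y _) (e-connected n) (target-over x y (e n) (z,w-over n)))

  -- After a full turn the lifted path lies over its initial vertex again, so its total displacement
  -- consists of whole periods.
  Δ-multiples : ∃₂ λ a b → Δx L ≡ a * + M × Δy L ≡ b * + N
  Δ-multiples = case subst (_over_ x y (z len , w len)) (cong source (e-period 0)) (z,w-over len) of λ where
      ((a , z≡) , (b , w≡)) → a , b , winding (+ toℕ (proj₁ (source (e 0)))) (Δx L) (a * + M) (z-period 0) z≡ , winding (+ toℕ (proj₂ (source (e 0)))) (Δy L) (b * + N) (w-period 0) w≡
    where
    winding : ∀ p δ c {s} → s ≡ p + + 0 + δ → s ≡ p + c → δ ≡ c
    winding p δ c {s} turn lift = linear≡ (sym turn +≡ lift)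
        (solve 4 (λ a b c d → a ⊖ b := c ⊕ con 0 ⊕ a ⊕ d ⊖ (d ⊕ (c ⊕ b))) refl δ c p s)

  mid-u mid-v : ℕ → ℤ
  mid-u n = + 2 * z n + + 1 + ξ x y (e n)
  mid-v n = + 2 * w n + + 1 + η x y (e n)

  mid : ∀ n → Midpoint x y (e n) (mid-u n) (mid-v n)
  mid n = midpoint x y (e n) (z,w-over n)

  loop-walk : ∀ {a b} → Δx L ≡ a * + M → Δy L ≡ b * + N → Walk (profile x) (profile y) a b
  loop-walk {a} {b} Δx≡ Δy≡ = record
    { period   = len
    ; u        = mid-u
    ; v        = mid-v
    ; odd      = λ n → midpoint-odd x y (e n) (mid n)
    ; move     = λ n → move-along x y (e n) (e (suc n)) (z n) (w n) (z,w-over n)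
        (subst (_over_ x y _) (e-connected n) (target-over x y (e n) (z,w-over n))) (e-alternating n) refl refl
        (cong (λ z → + 2 * z + + 1 + ξ x y (e (suc n))) (z-step n))
        (cong (λ w → + 2 * w + + 1 + η x y (e (suc n))) (w-step n))
    ; u-period = u-period
    ; v-period = v-period
    ; closing  = closing
    }
    where
    mid-shift : ∀ z s c P {δ} → δ ≡ c * P → + 2 * (z + δ) + + 1 + s ≡ + 2 * z + + 1 + s + c * (+ 2 * P)
    mid-shift z s c P {δ} δ≡ = linear≡ (δ≡ +≡ δ≡)
        (solve 5 (λ a b c d e → con 2 ⊗ (a ⊕ b) ⊕ con 1 ⊕ c ⊖ (con 2 ⊗ a ⊕ con 1 ⊕ c ⊕ d ⊗ (con 2 ⊗ e)) :=
            b ⊕ b ⊖ (d ⊗ e ⊕ d ⊗ e)) refl z δ s c P)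

    u-period : ∀ n → mid-u (n ℕ.+ len) ≡ mid-u n + a * (+ 2 * + M)
    u-period n = trans (cong₂ (λ z e → + 2 * z + + 1 + ξ x y e) (z-period n) (e-period n))
      (mid-shift (z n) (ξ x y (e n)) a (+ M) Δx≡)

    v-period : ∀ n → mid-v (n ℕ.+ len) ≡ mid-v n + b * (+ 2 * + N)
    v-period n = trans (cong₂ (λ w e → + 2 * w + + 1 + η x y e) (w-period n) (e-period n))
      (mid-shift (w n) (η x y (e n)) b (+ N) Δy≡)

    -- Shifting by whole turns reduces both indices to their remainders, which
    -- agree because the edges of the loop are distinct.
    quotients : ∀ f P c .{{_ : NonZero P}} → (∀ n → f (n ℕ.+ len) ≡ f n + c * (+ 2 * + P)) → ∀ m n α →
                m ℕ.% len ≡ n ℕ.% len → f m ≡ f n + α * (+ 2 * + P) → α ≡ (+ (m ℕ./ len) - + (n ℕ./ len)) * c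
    quotients f P c step m n α rem f≡ =
      ℤ.*-cancelʳ-≡ α ((+ (m ℕ./ len) - + (n ℕ./ len)) * c) (+ P)
        (ℤ.*-cancelˡ-≡ (+ 2) (α * + P) ((+ (m ℕ./ len) - + (n ℕ./ len)) * c * + P)
          (linear≡ (sym f≡ +≡ turns m +≡ sym (turns n) +≡ cong f rem)
              (solve 9 (λ a b c d e f g h i → con 2 ⊗ (a ⊗ b) ⊖ con 2 ⊗ ((c ⊖ d) ⊗ e ⊗ b) :=
                  f ⊕ a ⊗ (con 2 ⊗ b) ⊕ g ⊕ (h ⊕ d ⊗ (e ⊗ (con 2 ⊗ b))) ⊕ i ⊖ (g ⊕ (i ⊕ c ⊗ (e ⊗ (con 2 ⊗ b))) ⊕ f ⊕ h))
                refl α (+ P) (+ (m ℕ./ len)) (+ (n ℕ./ len)) c (f n) (f m) (f (n ℕ.% len)) (f (m ℕ.% len)))))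
      where
      turns : ∀ n → f n ≡ f (n ℕ.% len) + + (n ℕ./ len) * (c * (+ 2 * + P))
      turns n = trans (cong f (ℕ.m≡m%n+[m/n]*n n len))
        (iterate-period f len (c * (+ 2 * + P)) step (n ℕ./ len) (n ℕ.% len))

    closing : ∀ m n α β → mid-u m ≡ mid-u n + α * (+ 2 * + M) → mid-v m ≡ mid-v n + β * (+ 2 * + N) →
              ∃ λ l → α ≡ l * a × β ≡ l * b
    closing m n α β um vm =
      + (m ℕ./ len) - + (n ℕ./ len) ,
      quotients mid-u M a u-period m n α rem um ,
      quotients mid-v N b v-period m n β rem vm
      where
      -- Midpoints that agree up to periods belong to the same edge, and an edge occurs at only one
      -- index of the trail.
      rem : m ℕ.% len ≡ n ℕ.% len
      rem = e-injective m n (same-edge x y (e m) (e n) α β (mid m) (mid n) um vm)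

-- From walks to homology classes

/-cong-× : ∀ i j m n .{{_ : NonZero m}} .{{_ : NonZero n}} → i * + n ≡ j * + m → i ℚ./ m ≡ j ℚ./ n
/-cong-× i j (suc m) (suc n) eq = ℚ.fromℚᵘ-cong {mkℚᵘ i m} {mkℚᵘ j n} (*≡* eq)

2*≢0 : ∀ {i} → i ≢ + 0 → + 2 * i ≢ + 0
2*≢0 i≢0 2i≡0 = [ (λ ()) , i≢0 ]′ (ℤ.i*j≡0⇒i≡0∨j≡0 (+ 2) 2i≡0)

1≤+ : ∀ n .{{_ : NonZero n}} → + 1 ≤ + n
1≤+ n = ℤ.+≤+ (ℕ.>-nonZero⁻¹ n)

integral : ℤ × ℤ → ℚ × ℚ
integral (a , b) = a ℚ./ 1 , b ℚ./ 1

module _ {M N : ℕ} .{{_ : NonZero M}} .{{_ : NonZero N}} (x : Vec Sign N) (y : Vec Sign M) where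

  open Pattern x y using (Δx; Δy)

  winding-walk : (L : Loop x y) → Nontrivial x y L →
    ∃₂ λ a b → homologyClass x y L ≡ integral (a , b) × ¬ (a ≡ + 0 × b ≡ + 0) × Walk (profile x) (profile y) a b
  winding-walk L nontrivial = case Δ-multiples x y L of λ where
    (a , b , Δx≡ , Δy≡) → let
      class : homologyClass x y L ≡ integral (a , b)
      class = cong₂ _,_
        (/-cong-× (Δx L) a M 1 (trans (ℤ.*-identityʳ (Δx L)) Δx≡))
        (/-cong-× (Δy L) b N 1 (trans (ℤ.*-identityʳ (Δy L)) Δy≡))
      in a , b , class , (λ { (refl , refl) → nontrivial class }) , loop-walk x y L Δx≡ Δy≡

  -- The product of `l` and the gcd divides both `k x` and `k y`, hence divides the gcd. So `l = 1`,
  -- and `(a , b)` is the primitive vector.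
  reduce : ∀ {a b l} (kx≢0 : k x ≢ + 0) → + 1 ≤ l → k x ≡ l * a * + gcdₖ x y → k y ≡ l * b * + gcdₖ x y →
           integral (a , b) ≡ k/gcd x y kx≢0
  reduce {a} {b} {+ n} kx≢0 1≤l kx≡ ky≡ = cong₂ _,_
    (/-cong-× a (k x) 1 g (trans (a*g≡ a) (trans (sym kx≡) (sym (ℤ.*-identityʳ (k x))))))
    (/-cong-× b (k y) 1 g (trans (a*g≡ b) (trans (sym ky≡) (sym (ℤ.*-identityʳ (k y))))))
    where
    g = gcdₖ x y
    instance _ = gcdₖ-nonZero x y kx≢0

    ng∣ : ∀ {i} c → i ≡ + n * c * + g → n ℕ.* g ℕ.∣ ∣ i ∣
    ng∣ {i} c i≡ = Signed.∣⇒∣ᵤ (divides c (trans i≡ (trans (cong (_* + g) (ℤ.*-comm (+ n) c))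
      (trans (ℤ.*-assoc c (+ n) (+ g)) (cong (c *_) (sym (ℤ.pos-* n g)))))))

    n≤1 : n ℕ.≤ 1
    n≤1 = ℕ.*-cancelʳ-≤ n 1 g (subst (n ℕ.* g ℕ.≤_) (sym (ℕ.*-identityˡ g))
      (ℕ.∣⇒≤ (gcd-greatest (ng∣ a kx≡) (ng∣ b ky≡))))

    a*g≡ : ∀ a → a * + g ≡ + n * a * + g
    a*g≡ a = cong (_* + g) (trans (sym (ℤ.*-identityˡ a)) (cong (_* a) (ℤ.≤-antisym 1≤l (ℤ.+≤+ n≤1))))

  both-nonzero : (kx≢0 : k x ≢ + 0) → k y ≢ + 0 → (L : Loop x y) → Nontrivial x y L →
                 homologyClass x y L ≡ k/gcd x y kx≢0
  both-nonzero kx≢0 ky≢0 L nontrivial = case winding-walk L nontrivial of λ where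
      (a , b , class , ab≢0 , W) → case Signed.∣ᵤ⇒∣ {+ gcdₖ x y} {k x} (gcd[m,n]∣m ∣ k x ∣ ∣ k y ∣) of λ where
        (divides p kx≡) → case Signed.∣ᵤ⇒∣ {+ gcdₖ x y} {k y} (gcd[m,n]∣n ∣ k x ∣ ∣ k y ∣) of λ where
          -- The profiles gain `2 * k x` and `2 * k y` per period, so the common divisor doubles as
          -- well.
          (divides q ky≡) → case both-tilted (1≤+ N) (1≤+ M) (2*≢0 kx≢0) (2*≢0 ky≢0) W ab≢0 p q (+ 2 * + gcdₖ x y)
              (linear 1 (1≤g +≤ 1≤g)
                  (solve 1 (λ a → con 2 ⊗ a ⊖ con 1 := a ⊕ a ⊖ (con 1 ⊕ con 1) ⊕ con 1)
                    refl (+ gcdₖ x y))) (double {c = p} kx≡) (double {c = q} ky≡) of λ where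
            (l , 1≤l , p≡ , q≡) → trans class
              (reduce {a} {b} {l} kx≢0 1≤l (trans kx≡ (cong (_* + gcdₖ x y) p≡)) (trans ky≡ (cong (_* + gcdₖ x y) q≡)))
    where
    double : ∀ {i c} → i ≡ c * + gcdₖ x y → + 2 * i ≡ c * (+ 2 * + gcdₖ x y)
    double {i} {c} eq = linear≡ {x = + 2 * i} {c * (+ 2 * + gcdₖ x y)} (eq +≡ eq)
        (solve 3 (λ a b c → con 2 ⊗ a ⊖ b ⊗ (con 2 ⊗ c) := a ⊕ a ⊖ (b ⊗ c ⊕ b ⊗ c))
          refl i c (+ gcdₖ x y))
    1≤g : + 1 ≤ + gcdₖ x y
    1≤g = 1≤+ (gcdₖ x y)
      where instance _ = gcdₖ-nonZero x y kx≢0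

winds-vertically : ∀ {M N} .{{_ : NonZero M}} .{{_ : NonZero N}} (x : Vec Sign N) (y : Vec Sign M) {a b} →
  k x ≡ + 0 → Walk (profile x) (profile y) a b → b ≢ + 0 → (a , b) ≡ (+ 0 , + 1) ⊎ (a , b) ≡ (+ 0 , - + 1)
winds-vertically {N = N} x y kx≡0 W b≢0 = case level-rows (1≤+ N) (cong (+ 2 *_) kx≡0) W b≢0 of λ where
  (a≡ , inj₁ b≡) → inj₁ (cong₂ _,_ a≡ b≡)
  (a≡ , inj₂ b≡) → inj₂ (cong₂ _,_ a≡ b≡)

winds-horizontally : ∀ {M N} .{{_ : NonZero M}} .{{_ : NonZero N}} (x : Vec Sign N) (y : Vec Sign M) {a b} →
  k y ≡ + 0 → Walk (profile x) (profile y) a b → a ≢ + 0 → (a , b) ≡ (+ 1 , + 0) ⊎ (a , b) ≡ (- + 1 , + 0)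
winds-horizontally {M} x y ky≡0 W a≢0 = case level-rows (1≤+ M) (cong (+ 2 *_) ky≡0) (swap W) a≢0 of λ where
  (b≡ , inj₁ a≡) → inj₁ (cong₂ _,_ a≡ b≡)
  (b≡ , inj₂ a≡) → inj₂ (cong₂ _,_ a≡ b≡)

module _ {M N : ℕ} .{{_ : NonZero M}} .{{_ : NonZero N}} (x : Vec Sign N) (y : Vec Sign M) where

  rows-level : k x ≡ + 0 → k y ≢ + 0 → (L : Loop x y) → Nontrivial x y L →
    homologyClass x y L ≡ (0ℚ , 1ℚ) ⊎ homologyClass x y L ≡ (0ℚ , ℚ.- 1ℚ)
  rows-level kx≡0 ky≢0 L nontrivial = case winding-walk x y L nontrivial of λ where
    (a , b , class , ab≢0 , W) → let
      -- The class is parallel to `(0 , k y)`, which forces `a = 0`; nontriviality is then `b ≢ 0`.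
      aμ≡0 : a * (+ 2 * k y) ≡ + 0
      aμ≡0 = trans (sym (Walk.bκ≡aμ W)) (trans (cong (λ i → b * (+ 2 * i)) kx≡0) (ℤ.*-zeroʳ b))
      a≡0 : a ≡ + 0
      a≡0 = [ (λ a≡0 → a≡0) , (λ μ≡0 → ⊥-elim (2*≢0 ky≢0 μ≡0)) ]′ (ℤ.i*j≡0⇒i≡0∨j≡0 a aμ≡0)
      in Sum.map (trans class ∘ cong integral) (trans class ∘ cong integral)
           (winds-vertically x y kx≡0 W (λ b≡0 → ab≢0 (a≡0 , b≡0)))

  columns-level : k x ≢ + 0 → k y ≡ + 0 → (L : Loop x y) → Nontrivial x y L →
    homologyClass x y L ≡ (1ℚ , 0ℚ) ⊎ homologyClass x y L ≡ (ℚ.- 1ℚ , 0ℚ)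
  columns-level kx≢0 ky≡0 L nontrivial = case winding-walk x y L nontrivial of λ where
    (a , b , class , ab≢0 , W) → let
      bκ≡0 : b * (+ 2 * k x) ≡ + 0
      bκ≡0 = trans (Walk.bκ≡aμ W) (trans (cong (λ i → a * (+ 2 * i)) ky≡0) (ℤ.*-zeroʳ a))
      b≡0 : b ≡ + 0
      b≡0 = [ (λ b≡0 → b≡0) , (λ κ≡0 → ⊥-elim (2*≢0 kx≢0 κ≡0)) ]′ (ℤ.i*j≡0⇒i≡0∨j≡0 b bκ≡0)
      in Sum.map (trans class ∘ cong integral) (trans class ∘ cong integral)
           (winds-horizontally x y ky≡0 W (λ a≡0 → ab≢0 (a≡0 , b≡0)))

  both-level : k x ≡ + 0 → k y ≡ + 0 → (L : Loop x y) → Nontrivial x y L →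
    (homologyClass x y L ≡ (0ℚ , 1ℚ) ⊎ homologyClass x y L ≡ (0ℚ , ℚ.- 1ℚ)) ⊎
    (homologyClass x y L ≡ (1ℚ , 0ℚ) ⊎ homologyClass x y L ≡ (ℚ.- 1ℚ , 0ℚ))
  both-level kx≡0 ky≡0 L nontrivial = case winding-walk x y L nontrivial of λ where
    (a , b , class , ab≢0 , W) → case b ℤ.≟ + 0 of λ where
      (no b≢0)  → inj₁ (Sum.map (trans class ∘ cong integral) (trans class ∘ cong integral)
        (winds-vertically x y kx≡0 W b≢0))
      (yes b≡0) → inj₂ (Sum.map (trans class ∘ cong integral) (trans class ∘ cong integral)
        (winds-horizontally x y ky≡0 W (λ a≡0 → ab≢0 (a≡0 , b≡0))))

-- Symmetric patterns

module _ {N : ℕ} .{{_ : NonZero N}} (x : Vec Sign N) where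

  symmetric-positive : k x > 0ℤ → (L : Loop x x) → Nontrivial x x L → homologyClass x x L ≡ (1ℚ , 1ℚ)
  symmetric-positive k>0 L nontrivial = case winding-walk x x L nontrivial of λ where
    (a , b , class , ab≢0 , W) → let
      1≤k : + 1 ≤ k x
      1≤k = ℤ.i<j⇒suc[i]≤j k>0
      1≤κ : + 1 ≤ + 2 * k x
      1≤κ = linear 1 (1≤k +≤ 1≤k)
          (solve 1 (λ a → con 2 ⊗ a ⊖ con 1 := a ⊕ a ⊖ (con 1 ⊕ con 1) ⊕ con 1) refl (k x))
      -- With equal gains the divisor can be the gain itself. The vector is then `(1 , 1)`, and
      -- `1 = l * a = l * b` leaves only `a = b = 1`.
      in case positive-quadrant (1≤+ N) (1≤+ N) 1≤κ 1≤κ W ab≢0 (+ 1) (+ 1) (+ 2 * k x) 1≤κ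
                (sym (ℤ.*-identityˡ (+ 2 * k x))) (sym (ℤ.*-identityˡ (+ 2 * k x))) of λ where
        (l , 1≤l , 1≡la , 1≡lb) → trans class
          (cong₂ (λ a b → integral (a , b)) (unit-factor {l} {a} 1≤l 1≡la) (unit-factor {l} {b} 1≤l 1≡lb))

  symmetric-negative : k x < 0ℤ → (L : Loop x x) → Nontrivial x x L → homologyClass x x L ≡ (ℚ.- 1ℚ , ℚ.- 1ℚ)
  symmetric-negative k<0 L nontrivial = case winding-walk x x L nontrivial of λ where
      (a , b , class , ab≢0 , W) → let
        1+k≤0 : + 1 + k x ≤ + 0
        1+k≤0 = ℤ.i<j⇒suc[i]≤j k<0
        1≤-κ : + 1 ≤ - (+ 2 * k x)
        1≤-κ = linear 1 (1+k≤0 +≤ 1+k≤0)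
            (solve 1 (λ a → ⊝ (con 2 ⊗ a) ⊖ con 1 :=
                con 0 ⊕ con 0 ⊖ (con 1 ⊕ a ⊕ (con 1 ⊕ a)) ⊕ con 1) refl (k x))
        κ≢0 : + 2 * k x ≢ + 0
        κ≢0 = 2*≢0 (λ k≡0 → ℤ.<-irrefl k≡0 k<0)
        -- The divisor has to be positive, so it is the negated gain and the vector is `(-1 , -1)`.
        in case both-tilted (1≤+ N) (1≤+ N) κ≢0 κ≢0 W ab≢0 (- + 1) (- + 1) (- (+ 2 * k x)) 1≤-κ
                  (negate-twice (+ 2 * k x)) (negate-twice (+ 2 * k x)) of λ where
          (l , 1≤l , -1≡la , -1≡lb) → trans class
            (cong₂ (λ a b → integral (a , b)) (minus-one {l} {a} 1≤l -1≡la) (minus-one {l} {b} 1≤l -1≡lb))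
    where
    negate-twice : ∀ i → i ≡ - + 1 * - i
    negate-twice i = solve 1 (λ a → a := ⊝ con 1 ⊗ ⊝ a) refl i
    minus-one : ∀ {l c} → + 1 ≤ l → - + 1 ≡ l * c → c ≡ - + 1
    minus-one {l} {c} 1≤l eq = linear≡ (cong -_ (unit-factor {l} { - c} 1≤l (linear≡ (cong -_ eq)
        (solve 2 (λ a b → con 1 ⊖ a ⊗ ⊝ b := ⊝ (⊝ con 1) ⊖ ⊝ (a ⊗ b)) refl l c))))
        (solve 1 (λ a → a ⊖ ⊝ con 1 := ⊝ (⊝ a) ⊖ ⊝ con 1) refl c)

  -- The diagonal forces `a = b`, whereas level rows force `a = 0` as soon as `b ≢ 0`.
  symmetric-zero : k x ≡ 0ℤ → ¬ (∃[ L ] Nontrivial x x L)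
  symmetric-zero k≡0 (L , nontrivial) = case winding-walk x x L nontrivial of λ where
    (a , b , class , ab≢0 , W) → let a≡b = diagonal (1≤+ N) W in case b ℤ.≟ + 0 of λ where
      (yes b≡0) → ab≢0 (trans a≡b b≡0 , b≡0)
      (no b≢0)  → b≢0 (trans (sym a≡b) (proj₁ (level-rows (1≤+ N) (cong (+ 2 *_) k≡0) W b≢0)))

theorem1p5 : (∀ (N : ℕ) .{{_ : NonZero N}} → N ≥ 3 → (x : Vec Sign N) →
    (k x > 0ℤ → (L : Loop x x) → Nontrivial x x L → homologyClass x x L ≡ (1ℚ , 1ℚ)) ×
    (k x < 0ℤ → (L : Loop x x) → Nontrivial x x L → homologyClass x x L ≡ (ℚ.- 1ℚ , ℚ.- 1ℚ)) ×
    (k x ≡ 0ℤ → ¬ (∃[ L ] Nontrivial x x L)))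
    ×
    (∀ (M N : ℕ) .{{_ : NonZero M}} .{{_ : NonZero N}} → M ≥ 3 → N ≥ 3 →
    (x : Vec Sign N) (y : Vec Sign M) →
    ((kx≢0 : k x ≢ 0ℤ) → k y ≢ 0ℤ → (L : Loop x y) → Nontrivial x y L →
    homologyClass x y L ≡ k/gcd x y kx≢0) ×
    (k x ≡ 0ℤ → k y ≢ 0ℤ → (L : Loop x y) → Nontrivial x y L →
    homologyClass x y L ≡ (0ℚ , 1ℚ) ⊎ homologyClass x y L ≡ (0ℚ , ℚ.- 1ℚ)) ×
    (k x ≢ 0ℤ → k y ≡ 0ℤ → (L : Loop x y) → Nontrivial x y L →
    homologyClass x y L ≡ (1ℚ , 0ℚ) ⊎ homologyClass x y L ≡ (ℚ.- 1ℚ , 0ℚ)) ×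
    (k x ≡ 0ℤ → k y ≡ 0ℤ → (L : Loop x y) → Nontrivial x y L →
    (homologyClass x y L ≡ (0ℚ , 1ℚ) ⊎ homologyClass x y L ≡ (0ℚ , ℚ.- 1ℚ)) ⊎
    (homologyClass x y L ≡ (1ℚ , 0ℚ) ⊎ homologyClass x y L ≡ (ℚ.- 1ℚ , 0ℚ))))
theorem1p5 =
  (λ N _ x → symmetric-positive x , symmetric-negative x , symmetric-zero x) ,
  (λ M N _ _ x y → both-nonzero x y , rows-level x y , columns-level x y , both-level x y)
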